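{- For all $\alpha,\tau>0$ and every non-decreasing function $f:(0,1)\to(0,1)$, there exists $n_0$ such that the following holds. For every $d$-regular digraph $G$ on $n\ge n_0$ vertices with $d\ge\alpha n$, there exist $\rho,\nu$ with $$1/n_0\le\rho\le\nu\le\tau;\qquad \rho\le f(\nu);\qquad 1/n_0\le f(\rho),$$ a positive integer $k$, and a partition $\mathcal{P}=\{V_{ij}:i,j\in[k]\}$ of $V(G)$ (parts may be empty) such that for all $i,j\in[k]$: (i) $G[V_{i*},V_{*i}]$ is a bipartite robust $(\nu,\tau)$-expander with bipartition $V_{i*},V_{*i}$; (ii) for all $x\in V_{ij}$ and all $i',j'\in[k]$, $d^+(x,V_{*i})\ge d^+(x,V_{*i'})$ and $d^-(x,V_{j*})\ge d^-(x,V_{j'*})$; in particular $\delta(G[V_{i*},V_{*i}])\ge d/k$; (iii) $\big||V_{i*}|-|V_{*i}|\big|\le 2\rho n$; (iv) all but at most $2\rho n$ vertices $x\in V_{ij}$ satisfy $d^+(x,V_{*i})\ge d-2\rho n$ and $d^-(x,V_{j*})\ge d-2\rho n$; (v) $k\le n/(d-2\rho n)$.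
   Context: A digraph is $d$-regular if each vertex has exactly $d$ outneighbours and $d$ inneighbours. For a partition $\{V_{ij}:i,j\in[k]\}$, write $V_{i*}=V_{i1}\cup\dots\cup V_{ik}$ and $V_{*i}=V_{1i}\cup\dots\cup V_{ki}$. For $x\in V(G)$ and $S\subseteq V(G)$, $d^+(x,S)$ (resp. $d^-(x,S)$) is the number of outneighbours (resp. inneighbours) of $x$ in $S$. For $U,W\subseteq V(G)$ (not necessarily disjoint), $G[U,W]$ denotes the undirected bipartite graph with vertex classes a copy of $U$ and a copy of $W$ (vertices of $U\cap W$ appear twice, as distinct vertices), in which $u\in U$ and $w\in W$ are adjacent iff $uw$ is a directed edge of $G$; $\delta(\cdot)$ is its minimum degree. For an undirected graph $H$ on $N$ vertices and $S\subseteq V(H)$, $RN_{\nu,H}(S)$ is the set of vertices with at least $\nu N$ neighbours in $S$. A bipartite graph $H$ on $N$ vertices with bipartition $A,B$ is a bipartite robust $(\nu,\tau)$-expander with bipartition $A,B$ if every $S\subseteq A$ with $\tau|A|\le|S|\le(1-\tau)|A|$ satisfies $|RN_{\nu,H}(S)\cap B|\ge|S|+\nu N$.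
   Formalization: The quantities α, τ are taken rational and f is a non-decreasing rational-valued function on the rationals of (0,1); the real case follows by shrinking α, τ to rationals and replacing f by 1/⌈1/f⌉. -}

module Defs where

open import Data.Bool using (Bool; true; false; _∧_; not)
open import Data.Nat as ℕ using (ℕ; zero; suc)
open import Data.Fin using (Fin; zero; suc)
open import Data.Integer using (+_)
open import Data.Rational using (ℚ; _/_; _≤_; _<_; _≤ᵇ_; _+_; _*_; _-_; 0ℚ; 1ℚ)
open import Data.Product using (_×_; _,_; proj₁; proj₂)
open import Relation.Binary.PropositionalEquality using (_≡_)
open import Relation.Nullary using (¬_)
open import Relation.Nullary.Decidable using (⌊_⌋)
open import Data.Fin using (_≟_)

toℚ : ℕ → ℚ
toℚ n = + n / 1

VSet : ℕ → Set
VSet n = Fin n → Bool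

count : ∀ {n} → (Fin n → Bool) → ℕ
count {zero}  P = 0
count {suc n} P = (if P zero then 1 else 0) ℕ.+ count {n} (λ i → P (suc i))
  where
  if_then_else_ : Bool → ℕ → ℕ → ℕ
  if true  then a else b = a
  if false then a else b = b

∣_∣ˢ : ∀ {n} → VSet n → ℕ
∣ S ∣ˢ = count S

-- Digraph on vertex set Fin n: adjacency E x y = true iff xy is a directed edge.
-- Loopless (a digraph has no loops; at most one edge in each direction is
-- automatic from the Boolean adjacency).
record Digraph (n : ℕ) : Set where
  field
    E        : Fin n → Fin n → Bool
    loopless : ∀ x → E x x ≡ false
open Digraph public

outdeg : ∀ {n} → Digraph n → Fin n → VSet n → ℕ
outdeg G x S = count (λ y → E G x y ∧ S y)

indeg : ∀ {n} → Digraph n → Fin n → VSet n → ℕ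
indeg G x S = count (λ y → E G y x ∧ S y)

Regular : ∀ {n} → Digraph n → ℕ → Set
Regular {n} G d = ∀ x → outdeg G x (λ _ → true) ≡ d × indeg G x (λ _ → true) ≡ d

_⊆ˢ_ : ∀ {n} → VSet n → VSet n → Set
S ⊆ˢ U = ∀ x → S x ≡ true → U x ≡ true

-- In the bipartite graph H = G[U,W] on N = |U| + |W| vertices, a vertex w of
-- the W-class is in RN_{ν,H}(S) (S ⊆ U) iff it has at least νN neighbours
-- in S, i.e. #{u ∈ S : uw ∈ E(G)} ≥ νN.  This counts |RN_{ν,H}(S) ∩ B|.
RNcount : ∀ {n} → Digraph n → (U W S : VSet n) → ℚ → ℕ
RNcount G U W S ν =
  count (λ w → W w ∧ ((ν * toℚ (∣ U ∣ˢ ℕ.+ ∣ W ∣ˢ)) ≤ᵇ toℚ (count (λ u → S u ∧ E G u w))))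

BipRobustExpander : ∀ {n} → Digraph n → (U W : VSet n) → (ν τ : ℚ) → Set
BipRobustExpander G U W ν τ =
  ∀ (S : VSet _) → S ⊆ˢ U →
    τ * toℚ ∣ U ∣ˢ ≤ toℚ ∣ S ∣ˢ →
    toℚ ∣ S ∣ˢ ≤ (1ℚ - τ) * toℚ ∣ U ∣ˢ →
    toℚ ∣ S ∣ˢ + ν * toℚ (∣ U ∣ˢ ℕ.+ ∣ W ∣ˢ) ≤ toℚ (RNcount G U W S ν)

-- A partition {V_ij : i,j ∈ [k]} of Fin n is given by a labelling
-- part : Fin n → Fin k × Fin k  (x ∈ V_ij iff part x = (i , j)); parts may be empty.
Vij : ∀ {n k} → (Fin n → Fin k × Fin k) → Fin k → Fin k → VSet n
Vij p i j x = ⌊ proj₁ (p x) ≟ i ⌋ ∧ ⌊ proj₂ (p x) ≟ j ⌋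

Vrow : ∀ {n k} → (Fin n → Fin k × Fin k) → Fin k → VSet n
Vrow p i x = ⌊ proj₁ (p x) ≟ i ⌋

Vcol : ∀ {n k} → (Fin n → Fin k × Fin k) → Fin k → VSet n
Vcol p i x = ⌊ proj₂ (p x) ≟ i ⌋

MinDegBip≥ : ∀ {n} → Digraph n → (U W : VSet n) → ℚ → Set
MinDegBip≥ G U W m =
  (∀ u → U u ≡ true → m ≤ toℚ (outdeg G u W)) ×
  (∀ w → W w ≡ true → m ≤ toℚ (indeg G w U))

-- f is a non-decreasing map (0,1) → (0,1) (values outside (0,1) irrelevant)
MapsUnitInterval : (ℚ → ℚ) → Set
MapsUnitInterval f = ∀ x → 0ℚ < x → x < 1ℚ → (0ℚ < f x) × (f x < 1ℚ)

NonDecreasingOnUnit : (ℚ → ℚ) → Set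
NonDecreasingOnUnit f = ∀ x y → 0ℚ < x → x ≤ y → y < 1ℚ → f x ≤ f y

-- δ(G[U,W]) ≥ d/k, written without division as d ≤ k · deg (k > 0)
MinDegBip≥Frac : ∀ {n} → Digraph n → (U W : VSet n) → (d k : ℕ) → Set
MinDegBip≥Frac G U W d k =
  (∀ u → U u ≡ true → d ℕ.≤ k ℕ.* outdeg G u W) ×
  (∀ w → W w ≡ true → d ℕ.≤ k ℕ.* indeg G w U)

{-# OPTIONS --safe #-}

-- Pass to the bipartite double cover, where the partition is a pair of independent labellings
-- row, col : V → [k], and call an edge uw foreign if row u ≠ col w.  Starting from k = 1, keep
-- the number of foreign edges below εn² and every row class of linear size.  Markov's
-- inequality then provides in each class a vertex with few foreign edges, so all row and column
-- classes have size at least d − 2ρn, whence k ≤ 2/α.  Moving a vertex to a class in which it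
-- has more neighbours lowers the number of foreign edges; as the classes are much larger than
-- required, a single move cannot break the invariant, and after finitely many moves (ii) holds.
-- If some G[V_i*, V_*i] still fails to expand, witnessed by S, split off S from the rows and
-- RN(S) from the columns: regularity forces few edges between V_i* ∖ S and RN(S), so only
-- O(νn²) new foreign edges appear.  As k is bounded, this stops.  The constants, all of the
-- form 1/m, are chosen from the last stage backwards: foreign edges below εn² at one stage
-- allow ν = ε/8 at the previous one.
module Submission where

open import Algebra.Properties.Semiring.Sum as Sum using ()
open import Data.Bool using (Bool; true; false; _∧_; _∨_; not; if_then_else_)
import Data.Bool as Bool
open import Data.Bool.Properties using (∧-identityʳ; ∧-zeroʳ; ∨-zeroʳ; ¬-not; T-≡)
open import Data.Fin using (Fin; zero; suc; _≟_)
import Data.Fin.Properties as Fin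
open import Data.Fin.Subset.Properties using (anySubset?)
open import Data.Nat as ℕ using (ℕ; zero; suc)
open import Data.Nat.Induction using (Acc; acc; <-wellFounded)
import Data.Nat.Properties as ℕ
open import Data.Nat.Tactic.RingSolver using (solve-∀)
open import Data.Product using (_×_; _,_; ∃-syntax; Σ-syntax; proj₁; proj₂)
open import Data.Rational.Solver using (module +-*-Solver)
open import Data.Sum using (_⊎_; inj₁; inj₂)
open import Data.Vec using (lookup; tabulate)
open import Data.Vec.Functional using (updateAt)
open import Data.Vec.Functional.Properties using (updateAt-updates; updateAt-minimal)
open import Data.Vec.Properties using (lookup∘tabulate)
open import Defs
open import Function using (_∘_; const; flip; Equivalence)
open import Relation.Binary.PropositionalEquality using (_≡_; _≢_; refl; sym; trans; cong; cong₂; subst; subst₂; module ≡-Reasoning)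
open import Relation.Nullary using (¬_; Dec; yes; no; contradiction)
open import Relation.Nullary.Decidable using (⌊_⌋; _×-dec_; _→-dec_)

module Bipartite where

  open import Data.Nat using (z≤n; s≤s; _≤_; _<_; _+_; _*_)
  open import Data.Nat.Properties hiding (_≟_)
  open Sum +-*-semiring using (sum; sum-cong-≗; ∑-distrib-+; ∑-comm; *-distribˡ-sum)

  -- Sums and counts over finite sets

  ind : Bool → ℕ
  ind true  = 1
  ind false = 0

  count≡sum : ∀ {n} (P : VSet n) → count P ≡ sum (ind ∘ P)
  count≡sum {zero}  P = refl
  count≡sum {suc n} P with P zero
  ... | true  = cong suc (count≡sum (P ∘ suc))
  ... | false = count≡sum (P ∘ suc)

  sum-mono : ∀ {n} {f g : Fin n → ℕ} → (∀ i → f i ≤ g i) → sum f ≤ sum g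
  sum-mono {zero}  f≤g = z≤n
  sum-mono {suc n} f≤g = +-mono-≤ (f≤g zero) (sum-mono (f≤g ∘ suc))

  sum-mono-< : ∀ {n} {f g : Fin n → ℕ} → (∀ i → f i ≤ g i) → ∀ j → f j < g j → sum f < sum g
  sum-mono-< f≤g zero    fj<gj = +-mono-<-≤ fj<gj (sum-mono (f≤g ∘ suc))
  sum-mono-< f≤g (suc j) fj<gj = +-mono-≤-< (f≤g zero) (sum-mono-< (f≤g ∘ suc) j fj<gj)

  sum-const : ∀ n c → sum {n} (λ _ → c) ≡ n * c
  sum-const zero    c = refl
  sum-const (suc n) c = cong (c +_) (sum-const n c)

  sum-upper : ∀ {n} {f : Fin n → ℕ} {c} → (∀ i → f i ≤ c) → sum f ≤ n * c
  sum-upper {n} {c = c} f≤c = ≤-trans (sum-mono f≤c) (≤-reflexive (sum-const n c))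

  sum-lower : ∀ {n} {f : Fin n → ℕ} {c} → (∀ i → c ≤ f i) → n * c ≤ sum f
  sum-lower {n} {c = c} c≤f = ≤-trans (≤-reflexive (sym (sum-const n c))) (sum-mono c≤f)

  ind-mono : ∀ {a b} → (a ≡ true → b ≡ true) → ind a ≤ ind b
  ind-mono {true}  a⇒b rewrite a⇒b refl = ≤-refl
  ind-mono {false} a⇒b = z≤n

  count-cong : ∀ {n} (P Q : VSet n) → (∀ x → P x ≡ Q x) → count P ≡ count Q
  count-cong P Q P≗Q =
    trans (count≡sum P) (trans (sum-cong-≗ (cong ind ∘ P≗Q)) (sym (count≡sum Q)))

  count-mono : ∀ {n} (P Q : VSet n) → P ⊆ˢ Q → count P ≤ count Q
  count-mono P Q P⊆Q rewrite count≡sum P | count≡sum Q = sum-mono (λ x → ind-mono (P⊆Q x))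

  count-true : ∀ n → count {n} (λ _ → true) ≡ n
  count-true zero    = refl
  count-true (suc n) = cong suc (count-true n)

  count-false : ∀ n → count {n} (λ _ → false) ≡ 0
  count-false zero    = refl
  count-false (suc n) = count-false n

  count≤n : ∀ {n} (P : VSet n) → count P ≤ n
  count≤n {n} P = ≤-trans (count-mono P (λ _ → true) (λ _ _ → refl)) (≤-reflexive (count-true n))

  count-split : ∀ {n} (P Q : VSet n) →
    count (λ x → P x ∧ Q x) + count (λ x → P x ∧ not (Q x)) ≡ count P
  count-split P Q
    rewrite count≡sum (λ x → P x ∧ Q x) | count≡sum (λ x → P x ∧ not (Q x)) | count≡sum P
    = trans (sym (∑-distrib-+ (λ x → ind (P x ∧ Q x)) (λ x → ind (P x ∧ not (Q x))))) (sum-cong-≗ λ x → case (P x) (Q x))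
    where
    case : ∀ a b → ind (a ∧ b) + ind (a ∧ not b) ≡ ind a
    case true  true  = refl
    case true  false = refl
    case false _     = refl

  count-union : ∀ {n} (P Q R : VSet n) → (∀ x → P x ≡ true → Q x ≡ true ⊎ R x ≡ true) →
    count P ≤ count Q + count R
  count-union P Q R P⊆Q∪R
    rewrite count≡sum P | count≡sum Q | count≡sum R
    = ≤-trans (sum-mono λ x → case (P⊆Q∪R x)) (≤-reflexive (∑-distrib-+ (ind ∘ Q) (ind ∘ R)))
    where
    case : ∀ {a b c} → (a ≡ true → b ≡ true ⊎ c ≡ true) → ind a ≤ ind b + ind c
    case {false} h = z≤n
    case {true} {true}  {c} h = s≤s z≤n
    case {true} {false} {c} h with h refl
    ... | inj₂ refl = ≤-refl

  findIn∖ : ∀ {n} (P Q : VSet n) → count Q < count P → ∃[ x ] (P x ≡ true × Q x ≡ false)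
  findIn∖ P Q Q<P with Fin.any? (λ x → P x Bool.≟ true ×-dec Q x Bool.≟ false)
  ... | yes found = found
  ... | no ∄x = contradiction (count-mono P Q λ x Px → ¬-not (λ Qx → ∄x (x , Px , Qx))) (<⇒≱ Q<P)

  -- Controls the effect of relabelling one vertex `y`: a class loses at most one element.
  count-insert : ∀ {n} (P Q : VSet n) y → (∀ x → x ≢ y → P x ≡ true → Q x ≡ true) →
    count P ≤ suc (count Q)
  count-insert {suc n} P Q zero P⊆Q with P zero | Q zero
  ... | true  | true  = s≤s (m≤n⇒m≤1+n (count-mono (P ∘ suc) (Q ∘ suc) λ x → P⊆Q (suc x) λ ()))
  ... | true  | false = s≤s (count-mono (P ∘ suc) (Q ∘ suc) λ x → P⊆Q (suc x) λ ())
  ... | false | true  = m≤n⇒m≤1+n (m≤n⇒m≤1+n (count-mono (P ∘ suc) (Q ∘ suc) λ x → P⊆Q (suc x) λ ()))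
  ... | false | false = m≤n⇒m≤1+n (count-mono (P ∘ suc) (Q ∘ suc) λ x → P⊆Q (suc x) λ ())
  count-insert {suc n} P Q (suc y) P⊆Q
    with P zero | Q zero | P⊆Q zero (λ ()) | count-insert (P ∘ suc) (Q ∘ suc) y (λ x x≢y → P⊆Q (suc x) (x≢y ∘ Fin.suc-injective))
  ... | true  | true  | _ | ih = s≤s ih
  ... | true  | false | h | ih = contradiction (h refl) λ ()
  ... | false | true  | _ | ih = m≤n⇒m≤1+n ih
  ... | false | false | _ | ih = ih

  -- Each `x` with `g x` above `c` contributes at least `c` to the sum.
  markov : ∀ {n} (g : Fin n → ℕ) c → c * count (λ x → ⌊ c <? g x ⌋) ≤ sum g
  markov g c rewrite count≡sum (λ x → ⌊ c <? g x ⌋) =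
    ≤-trans (≤-reflexive (*-distribˡ-sum c (λ x → ind ⌊ c <? g x ⌋))) (sum-mono λ x → case x)
    where
    case : ∀ x → c * ind ⌊ c <? g x ⌋ ≤ g x
    case x with c <? g x
    ... | yes c<g = ≤-trans (≤-reflexive (*-identityʳ c)) (<⇒≤ c<g)
    ... | no _    = ≤-trans (≤-reflexive (*-zeroʳ c)) z≤n

  -- Boolean tests and the classes of a labelling

  ⌊⌋-true : ∀ {A : Set} (A? : Dec A) → ⌊ A? ⌋ ≡ true → A
  ⌊⌋-true (yes a) _ = a

  true-⌊⌋ : ∀ {A : Set} (A? : Dec A) → A → ⌊ A? ⌋ ≡ true
  true-⌊⌋ (yes _) _ = refl
  true-⌊⌋ (no ¬a) a = contradiction a ¬a

  ⌊⌋-false : ∀ {A : Set} (A? : Dec A) → ⌊ A? ⌋ ≡ false → ¬ A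
  ⌊⌋-false (no ¬a) _ = ¬a

  ∧-true : ∀ {a b} → a ∧ b ≡ true → a ≡ true × b ≡ true
  ∧-true {true} {true} _ = refl , refl

  ∧-intro : ∀ {a b} → a ≡ true → b ≡ true → a ∧ b ≡ true
  ∧-intro refl refl = refl

  class : ∀ {n k} → (Fin n → Fin k) → Fin k → VSet n
  class c i x = ⌊ c x ≟ i ⌋

  sum-singleton : ∀ {k} (j : Fin k) → sum (λ i → ind ⌊ j ≟ i ⌋) ≡ 1
  sum-singleton {suc k} zero =
    cong suc (trans (sum-const k 0) (*-zeroʳ k))
  sum-singleton {suc k} (suc j) = trans (sum-cong-≗ λ i → cong ind (case i)) (sum-singleton j)
    where
    case : ∀ i → ⌊ suc j ≟ suc i ⌋ ≡ ⌊ j ≟ i ⌋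
    case i with j ≟ i
    ... | yes _ = refl
    ... | no _  = refl

  -- Double counting: every `x` lies in exactly one class of the labelling `c`.
  sum-classes : ∀ {n k} (P : VSet n) (c : Fin n → Fin k) →
    sum (λ i → count (λ x → P x ∧ class c i x)) ≡ count P
  sum-classes P c = trans (sum-cong-≗ λ i → count≡sum (λ x → P x ∧ class c i x))
    (trans (∑-comm (λ i x → ind (P x ∧ class c i x)))
    (trans (sum-cong-≗ λ x → case (P x) (c x)) (sym (count≡sum P))))
    where
    case : ∀ {k} b (j : Fin k) → sum (λ i → ind (b ∧ ⌊ j ≟ i ⌋)) ≡ ind b
    case true  j = sum-singleton j
    case {k} false j = trans (sum-const k 0) (*-zeroʳ k)

  sum-class-sizes : ∀ {n k} (c : Fin n → Fin k) → sum (λ i → count (class c i)) ≡ n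
  sum-class-sizes {n} c = trans (sum-classes (λ _ → true) c) (count-true n)

  -- Edges across a pair of partitions

  pairs : ∀ {n} → (Fin n → Fin n → Bool) → ℕ
  pairs P = sum (λ u → count (P u))

  pairs-flip : ∀ {n} (P : Fin n → Fin n → Bool) → pairs P ≡ pairs (flip P)
  pairs-flip P = trans (sum-cong-≗ λ u → count≡sum (P u))
    (trans (∑-comm (λ u w → ind (P u w))) (sum-cong-≗ λ w → sym (count≡sum (flip P w))))

  pairs-cong : ∀ {n} (P Q : Fin n → Fin n → Bool) → (∀ u w → P u w ≡ Q u w) → pairs P ≡ pairs Q
  pairs-cong P Q P≗Q = sum-cong-≗ λ u → count-cong (P u) (Q u) (P≗Q u)

  pairs-union : ∀ {n} (P Q R : Fin n → Fin n → Bool) →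
    (∀ u w → P u w ≡ true → Q u w ≡ true ⊎ R u w ≡ true) → pairs P ≤ pairs Q + pairs R
  pairs-union P Q R P⊆Q∪R = ≤-trans (sum-mono λ u → count-union (P u) (Q u) (R u) (P⊆Q∪R u))
    (≤-reflexive (∑-distrib-+ (count ∘ Q) (count ∘ R)))

  ∨-true : ∀ {a b} → a ∨ b ≡ true → a ≡ true ⊎ b ≡ true
  ∨-true {true}  _    = inj₁ refl
  ∨-true {false} refl = inj₂ refl

  pairs-union₃ : ∀ {n} (P Q R S : Fin n → Fin n → Bool) →
    (∀ u w → P u w ≡ true → Q u w ≡ true ⊎ R u w ∨ S u w ≡ true) →
    pairs P ≤ pairs Q + (pairs R + pairs S)
  pairs-union₃ P Q R S h = ≤-trans (pairs-union P Q (λ u w → R u w ∨ S u w) h)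
    (+-monoʳ-≤ (pairs Q) (pairs-union (λ u w → R u w ∨ S u w) R S λ u w → ∨-true))

  -- The bipartite double cover of a regular digraph: rows label the out-copies of the vertices,
  -- columns the in-copies. `transpose` exchanges the two, so that an argument about rows serves for
  -- columns as well.
  record Biregular (n d : ℕ) : Set where
    field
      adj         : Fin n → Fin n → Bool
      out-regular : ∀ u → count (adj u) ≡ d
      in-regular  : ∀ w → count (flip adj w) ≡ d

  open Biregular public

  transpose : ∀ {n d} → Biregular n d → Biregular n d
  transpose Γ = record { adj = flip (adj Γ) ; out-regular = in-regular Γ ; in-regular = out-regular Γ }

  pairs-from : ∀ {n d} (Γ : Biregular n d) (S : VSet n) → pairs (λ u w → S u ∧ adj Γ u w) ≡ d * count S
  pairs-from {n} {d} Γ S = trans (sum-cong-≗ case)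
    (trans (sym (*-distribˡ-sum d (ind ∘ S))) (cong (d *_) (sym (count≡sum S))))
    where
    case : ∀ u → count (λ w → S u ∧ adj Γ u w) ≡ d * ind (S u)
    case u with S u
    ... | true  = trans (out-regular Γ u) (sym (*-identityʳ d))
    ... | false = trans (count-false n) (sym (*-zeroʳ d))

  deg : ∀ {n d k} → Biregular n d → Fin n → (Fin n → Fin k) → Fin k → ℕ
  deg Γ u b i = count (λ w → adj Γ u w ∧ class b i w)

  foreign : ∀ {n d k} → Biregular n d → (a b : Fin n → Fin k) → Fin n → ℕ
  foreign Γ a b u = count (λ w → adj Γ u w ∧ not (class b (a u) w))

  cross : ∀ {n d k} → Biregular n d → (a b : Fin n → Fin k) → ℕ
  cross Γ a b = sum (foreign Γ a b)

  deg+foreign : ∀ {n d k} (Γ : Biregular n d) (a b : Fin n → Fin k) u →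
    deg Γ u b (a u) + foreign Γ a b u ≡ d
  deg+foreign Γ a b u = trans (count-split (adj Γ u) (class b (a u))) (out-regular Γ u)

  deg≤size : ∀ {n d k} (Γ : Biregular n d) u (b : Fin n → Fin k) i → deg Γ u b i ≤ count (class b i)
  deg≤size Γ u b i = count-mono _ (class b i) λ w → proj₂ ∘ ∧-true {adj Γ u w}

  sum-deg : ∀ {n d k} (Γ : Biregular n d) u (b : Fin n → Fin k) → sum (deg Γ u b) ≡ d
  sum-deg Γ u b = trans (sum-classes (adj Γ u) b) (out-regular Γ u)

  class-sym : ∀ {n m k} (a : Fin n → Fin k) (b : Fin m → Fin k) u w → class b (a u) w ≡ class a (b w) u
  class-sym a b u w with b w ≟ a u | a u ≟ b w
  ... | yes _ | yes _ = refl
  ... | no _  | no _  = refl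
  ... | yes p | no ¬q = contradiction (sym p) ¬q
  ... | no ¬p | yes q = contradiction (sym q) ¬p

  -- In both readings `uw` is foreign when the labels `a u` and `b w` differ, and the double sum may
  -- be taken in either order.
  cross-transpose : ∀ {n d k} (Γ : Biregular n d) (a b : Fin n → Fin k) →
    cross (transpose Γ) b a ≡ cross Γ a b
  cross-transpose Γ a b = trans (pairs-flip (λ u w → adj Γ w u ∧ not (class a (b u) w)))
    (pairs-cong (λ u w → adj Γ u w ∧ not (class a (b w) u)) (λ u w → adj Γ u w ∧ not (class b (a u) w))
      λ u w → cong (λ c → adj Γ u w ∧ not c) (sym (class-sym a b u w)))

  -- Of the `d * count (class a i)` edges leaving row class `i`, at most `d * count (class b i)` end
  -- in column class `i`, and the others are foreign.
  size-balance : ∀ {n d k} (Γ : Biregular n d) (a b : Fin n → Fin k) i →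
    d * count (class a i) ≤ d * count (class b i) + cross Γ a b
  size-balance {d = d} Γ a b i = begin
    d * count (class a i)                        ≡⟨ pairs-from Γ (class a i) ⟨
    pairs (λ u w → class a i u ∧ adj Γ u w)      ≤⟨ pairs-union _ into _ covers ⟩
    pairs into + cross Γ a b                     ≡⟨ cong (_+ cross Γ a b) (trans (pairs-flip into) (pairs-from (transpose Γ) (class b i))) ⟩
    d * count (class b i) + cross Γ a b          ∎
    where
    open ≤-Reasoning
    into = λ u w → class b i w ∧ adj Γ u w
    covers : ∀ u w → class a i u ∧ adj Γ u w ≡ true →
      into u w ≡ true ⊎ adj Γ u w ∧ not (class b (a u) w) ≡ true
    covers u w h with ∧-true {class a i u} h
    ... | u∈Aᵢ , uw with ⌊⌋-true (a u ≟ i) u∈Aᵢ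
    ... | refl with class b (a u) w
    ... | true  = inj₁ uw
    ... | false = inj₂ (∧-intro uw refl)

  -- Vertices with many foreign edges, and the size of opposite classes

  bad : ∀ {n d k} → Biregular n d → (a b : Fin n → Fin k) → ℕ → VSet n
  bad {n} Γ a b R u = ⌊ 2 * n <? R * foreign Γ a b u ⌋

  -- With `ρ = 1/R`, a vertex is bad when more than `2ρn` of its edges are foreign. The total being
  -- at most `ρ²n²`, Markov's inequality leaves at most `ρn/2` such vertices.
  few-bad : ∀ {n d k} (Γ : Biregular n d) (a b : Fin n → Fin k) R → 0 < n →
    cross Γ a b * (R * R) ≤ n * n → 2 * R * count (bad Γ a b R) ≤ n
  few-bad {n@(suc _)} Γ a b R 0<n few = *-cancelˡ-≤ n (begin
    n * (2 * R * B)         ≡⟨ lemma n R B ⟩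
    R * (2 * n * B)         ≤⟨ *-monoʳ-≤ R (markov (λ u → R * foreign Γ a b u) (2 * n)) ⟩
    R * sum (λ u → R * foreign Γ a b u)  ≡⟨ cong (R *_) (*-distribˡ-sum R (foreign Γ a b)) ⟨
    R * (R * cross Γ a b)   ≡⟨ lemma′ R (cross Γ a b) ⟩
    cross Γ a b * (R * R)   ≤⟨ few ⟩
    n * n                   ∎)
    where
    open ≤-Reasoning
    B = count (bad Γ a b R)
    lemma : ∀ n R B → n * (2 * R * B) ≡ R * (2 * n * B)
    lemma = solve-∀
    lemma′ : ∀ R c → R * (R * c) ≡ c * (R * R)
    lemma′ = solve-∀

  -- The row class is too large to consist of bad vertices, and a good vertex in it has at least
  -- `d - 2n/R` neighbours in column class `i`, which must hold them all.
  opposite-class-size : ∀ {n d k} (Γ : Biregular n d) (a b : Fin n → Fin k) R T → 0 < n →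
    cross Γ a b * (R * R) ≤ n * n → T ≤ R → ∀ i → n ≤ T * count (class a i) →
    R * d ≤ R * count (class b i) + 2 * n
  opposite-class-size {n} {d} Γ a b R T 0<n few T≤R i large
    with findIn∖ (class a i) (bad Γ a b R) (≰⇒> λ Aᵢ≤bad → <⇒≱ 0<n (+-cancelˡ-≤ n n 0 (begin
      n + n                              ≡⟨ lemma n ⟩
      2 * n                              ≤⟨ *-monoʳ-≤ 2 large ⟩
      2 * (T * count (class a i))        ≡⟨ *-assoc 2 T _ ⟨
      2 * T * count (class a i)          ≤⟨ *-mono-≤ (*-monoʳ-≤ 2 T≤R) Aᵢ≤bad ⟩
      2 * R * count (bad Γ a b R)        ≤⟨ few-bad Γ a b R 0<n few ⟩
      n                                  ≡⟨ +-identityʳ n ⟨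
      n + 0                              ∎)))
    where
    open ≤-Reasoning
    lemma : ∀ n → n + n ≡ 2 * n
    lemma = solve-∀
  ... | u , u∈Aᵢ , good with ⌊⌋-true (a u ≟ i) u∈Aᵢ
  ... | refl = begin
    R * d                                                ≡⟨ cong (R *_) (deg+foreign Γ a b u) ⟨
    R * (deg Γ u b (a u) + foreign Γ a b u)              ≡⟨ *-distribˡ-+ R _ _ ⟩
    R * deg Γ u b (a u) + R * foreign Γ a b u            ≤⟨ +-mono-≤ (*-monoʳ-≤ R (deg≤size Γ u b (a u))) (≮⇒≥ (⌊⌋-false (2 * n <? _) good)) ⟩
    R * count (class b (a u)) + 2 * n                    ∎
    where open ≤-Reasoning

  -- Only the foreign edges of `u` change. As `deg` and `foreign` at `u` sum to `d`, gaining
  -- neighbours in the own class means losing foreign edges.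
  move-row : ∀ {n d k} (Γ : Biregular n d) (a b : Fin n → Fin k) u i →
    deg Γ u b (a u) < deg Γ u b i → cross Γ (updateAt a u (const i)) b < cross Γ a b
  move-row {d = d} Γ a b u i better = sum-mono-< mono u strict
    where
    a′ = updateAt a u (const i)
    strict : foreign Γ a′ b u < foreign Γ a b u
    strict = ≰⇒> λ fu≤f′u → <-irrefl refl (begin-strict
      d                                          ≡⟨ deg+foreign Γ a b u ⟨
      deg Γ u b (a u) + foreign Γ a b u          <⟨ +-mono-<-≤ better fu≤f′u ⟩
      deg Γ u b i + foreign Γ a′ b u             ≡⟨ cong (λ j → deg Γ u b j + foreign Γ a′ b u) (updateAt-updates u a) ⟨
      deg Γ u b (a′ u) + foreign Γ a′ b u        ≡⟨ deg+foreign Γ a′ b u ⟩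
      d                                          ∎)
      where open ≤-Reasoning
    mono : ∀ x → foreign Γ a′ b x ≤ foreign Γ a b x
    mono x with x ≟ u
    ... | yes refl = <⇒≤ strict
    ... | no x≢u = ≤-reflexive (cong (λ j → count (λ w → adj Γ x w ∧ not (class b j w)))
      (updateAt-minimal x u a x≢u))

  -- Splitting a class along a set that fails to expand

  splitOff : ∀ {n k} → VSet n → (Fin n → Fin k) → Fin n → Fin (suc k)
  splitOff S a x = if S x then zero else suc (a x)

  -- The robust neighbourhood of `S` in column class `i` for `ν = 1/N`, with the degree threshold
  -- multiplied out by `N`.
  RobustNbrs : ∀ {n d k} → Biregular n d → (a b : Fin n → Fin k) → ℕ → Fin k → VSet n → VSet n
  RobustNbrs Γ a b N i S w =
    class b i w ∧ ⌊ count (class a i) + count (class b i) ≤? N * count (λ u → S u ∧ adj Γ u w) ⌋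

  -- A new foreign edge either leaves `S` for a vertex of column class `i` outside `RN`, or enters
  -- `RN` from outside `S`. The first kind is rare by the definition of `RN`. For the second,
  -- regularity compares the `d * count RN` edges into `RN` with the `d * count S` edges out of `S`:
  -- as `RN` is hardly larger than `S`, nearly all edges into `RN` come from `S`.
  cross-splitOff : ∀ {n d k} (Γ : Biregular n d) (a b : Fin n → Fin k) N i S → d ≤ n → S ⊆ˢ class a i →
    N * count (RobustNbrs Γ a b N i S) < N * count S + (count (class a i) + count (class b i)) →
    N * cross Γ a b ≤ n * n →
    N * cross Γ (splitOff S a) (splitOff (RobustNbrs Γ a b N i S) b) ≤ 8 * (n * n)
  cross-splitOff {n} {d} Γ a b N i S d≤n S⊆Aᵢ poor few = begin
    N * cross Γ a′ b′        ≤⟨ *-monoʳ-≤ N (pairs-union₃ (λ u w → adj Γ u w ∧ not (class b′ (a′ u) w)) (λ u w → adj Γ u w ∧ not (class b (a u) w)) lost extra covers) ⟩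
    N * (X + (Y + Z))        ≡⟨ lemma₁ N X Y Z ⟩
    N * X + N * Y + N * Z    ≤⟨ +-monoʳ-≤ (N * X + N * Y) NZ≤ ⟩
    N * X + N * Y + (N * Y + N * X + 2 * (n * n)) ≤⟨ +-mono-≤ (+-mono-≤ few NY≤) (+-monoˡ-≤ (2 * (n * n)) (+-mono-≤ NY≤ few)) ⟩
    n * n + 2 * (n * n) + (2 * (n * n) + n * n + 2 * (n * n)) ≡⟨ lemma₂ (n * n) ⟩
    8 * (n * n)              ∎
    where
    open ≤-Reasoning
    RN = RobustNbrs Γ a b N i S
    M  = count (class a i) + count (class b i)
    a′ = splitOff S a
    b′ = splitOff RN b
    lost kept extra : Fin n → Fin n → Bool
    -- `lost` edges run from `S` to the part of column class `i` outside `RN`, `kept` edges from `S`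
    -- to `RN`, and `extra` edges into `RN` from outside `S`.
    lost  u w = (class b i w ∧ not (RN w)) ∧ (S u ∧ adj Γ u w)
    kept  u w = (RN w ∧ adj Γ u w) ∧ S u
    extra u w = (RN w ∧ adj Γ u w) ∧ not (S u)
    X = cross Γ a b
    Y = pairs lost
    Z = pairs extra
    Q = pairs kept

    lemma₁ : ∀ N X Y Z → N * (X + (Y + Z)) ≡ N * X + N * Y + N * Z
    lemma₁ = solve-∀
    lemma₂ : ∀ m → m + 2 * m + (2 * m + m + 2 * m) ≡ 8 * m
    lemma₂ = solve-∀

    M≤2n : M ≤ 2 * n
    M≤2n = ≤-trans (+-mono-≤ (count≤n (class a i)) (count≤n (class b i))) (≤-reflexive (lemma n))
      where
      lemma : ∀ n → n + n ≡ 2 * n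
      lemma = solve-∀

    covers : ∀ u w → adj Γ u w ∧ not (class b′ (a′ u) w) ≡ true →
      adj Γ u w ∧ not (class b (a u) w) ≡ true ⊎ lost u w ∨ extra u w ≡ true
    covers u w h with adj Γ u w
    ... | true with S u in Su | RN w in RNw
    ...   | false | true  = inj₂ (∨-zeroʳ _)
    ...   | true  | false with ⌊⌋-true (a u ≟ i) (S⊆Aᵢ u Su)
    ...     | refl with class b (a u) w
    ...       | true  = inj₂ refl
    ...       | false = inj₁ refl
    covers u w h | true | false | false with b w ≟ a u
    ...     | no _  = inj₁ refl

    NY≤ : N * Y ≤ 2 * (n * n)
    NY≤ = begin
      N * Y                                  ≡⟨ cong (N *_) (pairs-flip lost) ⟩
      N * pairs (flip lost)                  ≡⟨ *-distribˡ-sum N (λ w → count (flip lost w)) ⟩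
      -- A vertex of column class `i` outside `RN` receives fewer than `M / N` edges from `S`.
      sum (λ w → N * count (flip lost w))    ≤⟨ sum-upper (λ w → ≤-trans (case w) M≤2n) ⟩
      n * (2 * n)                            ≡⟨ lemma n ⟩
      2 * (n * n)                            ∎
      where
      lemma : ∀ n → n * (2 * n) ≡ 2 * (n * n)
      lemma = solve-∀
      case : ∀ w → N * count (flip lost w) ≤ M
      case w with class b i w | M ≤? N * count (λ u → S u ∧ adj Γ u w)
      ... | true  | no M≰ = <⇒≤ (≰⇒> M≰)
      ... | true  | yes _ = ≤-trans (≤-reflexive (trans (cong (N *_) (count-false n)) (*-zeroʳ N))) z≤n
      ... | false | _     = ≤-trans (≤-reflexive (trans (cong (N *_) (count-false n)) (*-zeroʳ N))) z≤n

    Q+Z : Q + Z ≡ d * count RN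
    Q+Z = trans (sym (∑-distrib-+ (count ∘ kept) (count ∘ extra)))
      (trans (sum-cong-≗ λ u → split u)
      (trans (pairs-flip (λ u w → RN w ∧ adj Γ u w)) (pairs-from (transpose Γ) RN)))
      where
      split : ∀ u → count (kept u) + count (extra u) ≡ count (λ w → RN w ∧ adj Γ u w)
      split u = count-split (λ w → RN w ∧ adj Γ u w) (λ _ → S u)

    dS≤ : d * count S ≤ X + (Y + Q)
    dS≤ = ≤-trans (≤-reflexive (sym (pairs-from Γ S)))
      (pairs-union₃ (λ u w → S u ∧ adj Γ u w) (λ u w → adj Γ u w ∧ not (class b (a u) w)) lost kept covers′)
      where
      covers′ : ∀ u w → S u ∧ adj Γ u w ≡ true →
        adj Γ u w ∧ not (class b (a u) w) ≡ true ⊎ lost u w ∨ kept u w ≡ true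
      covers′ u w h with S u in Su | adj Γ u w
      ... | true | true with ⌊⌋-true (a u ≟ i) (S⊆Aᵢ u Su)
      ...   | refl with class b (a u) w | M ≤? N * count (λ u → S u ∧ adj Γ u w)
      ...     | false | _     = inj₁ refl
      ...     | true  | yes _ = inj₂ refl
      ...     | true  | no _  = inj₂ refl

    NZ≤ : N * Z ≤ N * Y + N * X + 2 * (n * n)
    -- The `kept` edges occur both among the edges into `RN` and among those out of `S`, and cancel.
    NZ≤ = +-cancelˡ-≤ (N * Q) _ _ (begin
      N * Q + N * Z                          ≡⟨ *-distribˡ-+ N Q Z ⟨
      N * (Q + Z)                            ≡⟨ cong (N *_) Q+Z ⟩
      N * (d * count RN)                     ≡⟨ lemma N d (count RN) ⟩
      d * (N * count RN)                     ≤⟨ *-monoʳ-≤ d (<⇒≤ poor) ⟩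
      d * (N * count S + M)                  ≤⟨ *-monoʳ-≤ d (+-monoʳ-≤ (N * count S) M≤2n) ⟩
      d * (N * count S + 2 * n)              ≡⟨ lemma′ d N (count S) n ⟩
      N * (d * count S) + d * (2 * n)        ≤⟨ +-mono-≤ (*-monoʳ-≤ N dS≤) (*-monoˡ-≤ (2 * n) d≤n) ⟩
      N * (X + (Y + Q)) + n * (2 * n)        ≡⟨ lemma″ N X Y Q n ⟩
      N * Q + (N * Y + N * X + 2 * (n * n))  ∎)
      where
      lemma : ∀ N d r → N * (d * r) ≡ d * (N * r)
      lemma = solve-∀
      lemma′ : ∀ d N s n → d * (N * s + 2 * n) ≡ N * (d * s) + d * (2 * n)
      lemma′ = solve-∀
      lemma″ : ∀ N X Y Q n → N * (X + (Y + Q)) + n * (2 * n) ≡ N * Q + (N * Y + N * X + 2 * (n * n))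
      lemma″ = solve-∀

  -- Moving a vertex and splitting a class

  -- The real constants of the theorem enter through integers: α ≥ 1/A, τ ≥ 1/t, ρ = 1/R, ν = 1/N.
  record Scale (n d A t R : ℕ) : Set where
    field
      n-positive : 0 < n
      A-positive : 0 < A
      t-positive : 0 < t
      dense      : n ≤ A * d
      d≤n        : d ≤ n
      n-large    : 4 * A ≤ n
      R-large    : 4 * A * t ≤ R

    4A≤4At : 4 * A ≤ 4 * A * t
    4A≤4At = m≤m*n (4 * A) t where instance _ = ℕ.>-nonZero t-positive

    4A≤R : 4 * A ≤ R
    4A≤R = ≤-trans 4A≤4At R-large

    4≤R : 4 ≤ R
    4≤R = ≤-trans (m≤m*n 4 A) 4A≤R where instance _ = ℕ.>-nonZero A-positive

    R-positive : 0 < R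
    R-positive = ≤-trans (s≤s z≤n) 4≤R

    d-positive : 0 < d
    d-positive = ≰⇒> λ d≤0 → <⇒≱ n-positive
      (≤-trans dense (≤-trans (*-monoʳ-≤ A d≤0) (≤-reflexive (*-zeroʳ A))))

    -- The loss `2n/R` is at most `d/2`, because `n ≤ A * d` and `4 * A ≤ R`.
    half-degree : ∀ {x} → R * d ≤ R * x + 2 * n → d ≤ 2 * x
    half-degree {x} h = *-cancelˡ-≤ R (+-cancelˡ-≤ (R * d) _ _ (begin
      R * d + R * d              ≡⟨ lemma₁ (R * d) ⟩
      2 * (R * d)                ≤⟨ *-monoʳ-≤ 2 h ⟩
      2 * (R * x + 2 * n)        ≤⟨ *-monoʳ-≤ 2 (+-monoʳ-≤ (R * x) (*-monoʳ-≤ 2 dense)) ⟩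
      2 * (R * x + 2 * (A * d))  ≡⟨ lemma₂ R x A d ⟩
      4 * A * d + R * (2 * x)    ≤⟨ +-monoˡ-≤ (R * (2 * x)) (*-monoˡ-≤ d 4A≤R) ⟩
      R * d + R * (2 * x)        ∎))
      where
      open ≤-Reasoning
      instance _ = ℕ.>-nonZero R-positive
      lemma₁ : ∀ m → m + m ≡ 2 * m
      lemma₁ = solve-∀
      lemma₂ : ∀ R x A d → 2 * (R * x + 2 * (A * d)) ≡ 4 * A * d + R * (2 * x)
      lemma₂ = solve-∀

    n≤2Ax : ∀ {x} → d ≤ 2 * x → n ≤ 2 * A * x
    n≤2Ax {x} h = ≤-trans dense (≤-trans (*-monoʳ-≤ A h) (≤-reflexive (lemma A x)))
      where
      lemma : ∀ A x → A * (2 * x) ≡ 2 * A * x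
      lemma = solve-∀

    -- Supplies the row bound of the invariant for a piece of size `y` that keeps a fraction `1/t`
    -- of a class of size `x`.
    n≤4Atx : ∀ {x y} → d ≤ 2 * x → x ≤ t * y → n ≤ 4 * A * t * y
    n≤4Atx {x} {y} h x≤ty = begin
      n                ≤⟨ n≤2Ax h ⟩
      2 * A * x        ≤⟨ *-mono-≤ (*-monoˡ-≤ A (s≤s (s≤s (z≤n {2})))) x≤ty ⟩
      4 * A * (t * y)  ≡⟨ *-assoc (4 * A) t y ⟨
      4 * A * t * y    ∎
      where open ≤-Reasoning

  -- The invariant of the process. Foreign edges number at most `ρ²n²/A`: the factor `R * R` serves
  -- Markov's inequality, and the factor `A` turns `n * n` into `n * d` when class sizes are
  -- compared. The size bound is recorded for rows; one for columns follows from it.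
  record State {n d k} (Γ : Biregular n d) (A t R : ℕ) (a b : Fin n → Fin k) : Set where
    constructor state
    field
      few-cross : cross Γ a b * (R * R * A) ≤ n * n
      large     : ∀ i → n ≤ 4 * A * t * count (class a i)

  open State public

  few-cross′ : ∀ {n d k A t R} {Γ : Biregular n d} {a b : Fin n → Fin k} → Scale n d A t R →
    State Γ A t R a b → cross Γ a b * (R * R) ≤ n * n
  few-cross′ {A = A} {R = R} {Γ} {a} {b} sc st =
    ≤-trans (*-monoʳ-≤ (cross Γ a b) (m≤m*n (R * R) A)) (few-cross st)
    where instance _ = ℕ.>-nonZero (Scale.A-positive sc)

  col-size : ∀ {n d k A t R} {Γ : Biregular n d} {a b : Fin n → Fin k} → Scale n d A t R →
    State Γ A t R a b → ∀ i → R * d ≤ R * count (class b i) + 2 * n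
  col-size {A = A} {t} {R} {Γ} {a} {b} sc st i =
    opposite-class-size Γ a b R (4 * A * t) n-positive (few-cross′ sc st) R-large i (large st i)
    where open Scale sc

  -- A bootstrap: the weak bound `large` on rows gives a strong bound on columns, and this, read in
  -- the transposed graph, gives a strong bound on rows.
  row-size : ∀ {n d k A t R} {Γ : Biregular n d} {a b : Fin n → Fin k} → Scale n d A t R →
    State Γ A t R a b → ∀ i → R * d ≤ R * count (class a i) + 2 * n
  row-size {A = A} {t} {R} {Γ} {a} {b} sc st i =
    opposite-class-size (transpose Γ) b a R (4 * A * t) n-positive
      (subst (λ c → c * (R * R) ≤ _) (sym (cross-transpose Γ a b)) (few-cross′ sc st)) R-large i
      (n≤4Atx (half-degree (col-size sc st i)) (m≤n*m _ t))
    where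
    open Scale sc
    instance _ = ℕ.>-nonZero t-positive

  -- The row classes are disjoint, each has at least `d/2` elements, and `n ≤ A * d`.
  number-of-classes : ∀ {n d k A t R} {Γ : Biregular n d} {a b : Fin n → Fin k} → Scale n d A t R →
    State Γ A t R a b → k ≤ 2 * A
  number-of-classes {n} {d} {k} {A} {a = a} sc st = *-cancelʳ-≤ k (2 * A) d (begin
    k * d                                  ≤⟨ sum-lower (λ i → half-degree (row-size sc st i)) ⟩
    sum (λ i → 2 * count (class a i))      ≡⟨ *-distribˡ-sum 2 (λ i → count (class a i)) ⟨
    2 * sum (λ i → count (class a i))      ≡⟨ cong (2 *_) (sum-class-sizes a) ⟩
    2 * n                                  ≤⟨ *-monoʳ-≤ 2 dense ⟩
    2 * (A * d)                            ≡⟨ *-assoc 2 A d ⟨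
    2 * A * d                              ∎)
    where
    open Scale sc
    open ≤-Reasoning
    instance _ = ℕ.>-nonZero d-positive

  -- Before the move every row class is at least twice as large as the invariant demands, and
  -- `4 * A ≤ n` covers the single vertex that it may lose.
  move-row-state : ∀ {n d k A t R} {Γ : Biregular n d} {a b : Fin n → Fin k} → Scale n d A t R →
    State Γ A t R a b → ∀ u i → deg Γ u b (a u) < deg Γ u b i → State Γ A t R (updateAt a u (const i)) b
  move-row-state {n} {A = A} {t} {R} {Γ} {a} {b} sc st u i better = state
    (≤-trans (*-monoˡ-≤ (R * R * A) (<⇒≤ (move-row Γ a b u i better))) (few-cross st))
    λ j → +-cancelˡ-≤ n _ _ (begin
      n + n                                   ≤⟨ +-mono-≤ (n≤2Ax (half-degree (row-size sc st j))) (n≤2Ax (half-degree (row-size sc st j))) ⟩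
      2 * A * size j + 2 * A * size j         ≡⟨ lemma A (size j) ⟩
      4 * A * size j                          ≤⟨ *-monoʳ-≤ (4 * A) (count-insert (class a j) (class a′ j) u λ x x≢u → subst (λ y → ⌊ y ≟ j ⌋ ≡ true) (sym (updateAt-minimal x u a x≢u))) ⟩
      4 * A * suc (count (class a′ j))        ≡⟨ *-suc (4 * A) _ ⟩
      4 * A + 4 * A * count (class a′ j)      ≤⟨ +-mono-≤ n-large (*-monoˡ-≤ (count (class a′ j)) 4A≤4At) ⟩
      n + 4 * A * t * count (class a′ j)      ∎)
    where
    open Scale sc
    open ≤-Reasoning
    a′ = updateAt a u (const i)
    size = λ j → count (class a j)
    lemma : ∀ A x → 2 * A * x + 2 * A * x ≡ 4 * A * x
    lemma = solve-∀

  move-col : ∀ {n d k} (Γ : Biregular n d) (a b : Fin n → Fin k) w j →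
    deg (transpose Γ) w a (b w) < deg (transpose Γ) w a j → cross Γ a (updateAt b w (const j)) < cross Γ a b
  move-col Γ a b w j better = begin-strict
    cross Γ a b′              ≡⟨ cross-transpose Γ a b′ ⟨
    cross (transpose Γ) b′ a  <⟨ move-row (transpose Γ) b a w j better ⟩
    cross (transpose Γ) b a   ≡⟨ cross-transpose Γ a b ⟩
    cross Γ a b               ∎
    where
    open ≤-Reasoning
    b′ = updateAt b w (const j)

  Optimal : ∀ {n d k} → Biregular n d → (a b : Fin n → Fin k) → Set
  Optimal Γ a b = ∀ u i → deg Γ u b i ≤ deg Γ u b (a u)

  optimal? : ∀ {n d k} (Γ : Biregular n d) (a b : Fin n → Fin k) →
    Optimal Γ a b ⊎ (∃[ u ] ∃[ i ] deg Γ u b (a u) < deg Γ u b i)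
  optimal? Γ a b with Fin.any? (λ u → Fin.any? (λ i → deg Γ u b (a u) <? deg Γ u b i))
  ... | yes (u , i , better) = inj₂ (u , i , better)
  ... | no none = inj₁ λ u i → ≮⇒≥ λ better → none (u , i , better)

  -- Every move lowers `cross`, which drives the recursion. Column moves leave the row classes
  -- alone, so `large` is passed on unchanged.
  settle : ∀ {n d k A t R} (Γ : Biregular n d) (a b : Fin n → Fin k) → Scale n d A t R →
    State Γ A t R a b → Acc _<_ (cross Γ a b) →
    ∃[ a′ ] ∃[ b′ ] (State {k = k} Γ A t R a′ b′ × Optimal Γ a′ b′ × Optimal (transpose Γ) b′ a′)
  settle {A = A} {t} {R} Γ a b sc st (acc rec) with optimal? Γ a b
  ... | inj₂ (u , i , better) =
    settle Γ (updateAt a u (const i)) b sc (move-row-state sc st u i better) (rec (move-row Γ a b u i better))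
  ... | inj₁ rows with optimal? (transpose Γ) b a
  ...   | inj₁ cols = a , b , st , rows , cols
  ...   | inj₂ (w , j , better) = settle Γ a (updateAt b w (const j)) sc
    (state (≤-trans (*-monoˡ-≤ (R * R * A) (<⇒≤ (move-col Γ a b w j better))) (few-cross st)) (large st))
    (rec (move-col Γ a b w j better))

  -- Expansion, its failure, and the invariant after a split

  Medium : ∀ {n k} → (Fin n → Fin k) → ℕ → Fin k → VSet n → Set
  Medium a t i S = S ⊆ˢ class a i × count (class a i) ≤ t * count S ×
    t * count S + count (class a i) ≤ t * count (class a i)

  Expands : ∀ {n d k} → Biregular n d → (a b : Fin n → Fin k) → (N t : ℕ) → Set
  Expands Γ a b N t = ∀ i S → Medium a t i S →
    N * count S + (count (class a i) + count (class b i)) ≤ N * count (RobustNbrs Γ a b N i S)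

  Violates : ∀ {n d k} → Biregular n d → (a b : Fin n → Fin k) → (N t : ℕ) → Fin k → VSet n → Set
  Violates Γ a b N t i S = Medium a t i S ×
    N * count (RobustNbrs Γ a b N i S) < N * count S + (count (class a i) + count (class b i))

  violates? : ∀ {n d k} (Γ : Biregular n d) (a b : Fin n → Fin k) N t i S → Dec (Violates Γ a b N t i S)
  violates? Γ a b N t i S =
    (Fin.all? (λ x → S x Bool.≟ true →-dec class a i x Bool.≟ true) ×-dec (_ ≤? _) ×-dec (_ ≤? _)) ×-dec (_ <? _)

  -- Carries a violation from a Boolean function to the vector that tabulates it, since the search
  -- below runs over vectors.
  violates-cong : ∀ {n d k} (Γ : Biregular n d) (a b : Fin n → Fin k) N t i {S S′ : VSet n} →
    (∀ x → S x ≡ S′ x) → Violates Γ a b N t i S → Violates Γ a b N t i S′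
  violates-cong Γ a b N t i {S} {S′} S≗S′ ((sub , lower , upper) , poor)
    rewrite count-cong S S′ S≗S′
          | count-cong (RobustNbrs Γ a b N i S) (RobustNbrs Γ a b N i S′) (λ w →
              cong (λ c → class b i w ∧ ⌊ count (class a i) + count (class b i) ≤? N * c ⌋)
                (count-cong (λ u → S u ∧ adj Γ u w) (λ u → S′ u ∧ adj Γ u w) λ u → cong (_∧ adj Γ u w) (S≗S′ u)))
    = ((λ x S′x → sub x (trans (S≗S′ x) S′x)) , lower , upper) , poor

  -- The finitely many subsets can be searched, so either expansion holds or a concrete set to split
  -- along is found.
  expands? : ∀ {n d k} (Γ : Biregular n d) (a b : Fin n → Fin k) N t →
    Expands Γ a b N t ⊎ (∃[ i ] ∃[ S ] Violates Γ a b N t i S)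
  expands? Γ a b N t with Fin.any? (λ i → anySubset? (λ S → violates? Γ a b N t i (lookup S)))
  ... | yes (i , S , viol) = inj₂ (i , lookup S , viol)
  ... | no none = inj₁ λ i S medium → ≮⇒≥ λ poor → none (i , tabulate S ,
    violates-cong Γ a b N t i (sym ∘ lookup∘tabulate S) (medium , poor))

  -- By the upper bound in `Medium`, the remainder of class `i` keeps at least a fraction `1/t` of
  -- it; the other classes do not meet `S`.
  large-splitOff : ∀ {n k} (a : Fin n → Fin k) t i S → 0 < t → Medium a t i S →
    ∀ j → count (class a j) ≤ t * count (class (splitOff S a) (suc j))
  large-splitOff a t i S 0<t (S⊆Aᵢ , _ , upper) j with j ≟ i
  ... | yes refl = +-cancelˡ-≤ (t * count S) _ _ (begin
    t * count S + count (class a i)   ≤⟨ upper ⟩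
    t * count (class a i)             ≤⟨ *-monoʳ-≤ t (count-union (class a i) S (class (splitOff S a) (suc i)) covers) ⟩
    t * (count S + count (class (splitOff S a) (suc i))) ≡⟨ *-distribˡ-+ t _ _ ⟩
    t * count S + t * count (class (splitOff S a) (suc i)) ∎)
    where
    open ≤-Reasoning
    covers : ∀ x → class a i x ≡ true → S x ≡ true ⊎ class (splitOff S a) (suc i) x ≡ true
    covers x x∈Aᵢ with S x
    ... | true  = inj₁ refl
    ... | false = inj₂ (true-⌊⌋ (suc (a x) ≟ suc i) (cong suc (⌊⌋-true (a x ≟ i) x∈Aᵢ)))
  ... | no j≢i = ≤-trans (count-mono (class a j) (class (splitOff S a) (suc j)) stays) (m≤n*m _ t)
    where
    instance _ = ℕ.>-nonZero 0<t
    stays : class a j ⊆ˢ class (splitOff S a) (suc j)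
    stays x x∈Aⱼ with S x in Sx
    ... | true  = contradiction (trans (sym (⌊⌋-true (a x ≟ j) x∈Aⱼ)) (⌊⌋-true (a x ≟ i) (S⊆Aᵢ x Sx))) j≢i
    ... | false = true-⌊⌋ (suc (a x) ≟ suc j) (cong suc (⌊⌋-true (a x ≟ j) x∈Aⱼ))

  splitOff-zero : ∀ {n k} (a : Fin n → Fin k) S x → S x ≡ true → class (splitOff S a) zero x ≡ true
  splitOff-zero a S x Sx rewrite Sx = refl

  split-state : ∀ {n d k A t R N E′} {Γ : Biregular n d} {a b : Fin n → Fin k} → Scale n d A t R →
    N ≤ R → 8 * E′ ≤ N → State Γ A t R a b → ∀ i S → Violates Γ a b N t i S →
    let a′ = splitOff S a ; b′ = splitOff (RobustNbrs Γ a b N i S) b in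
    cross Γ a′ b′ * E′ ≤ n * n × (∀ j → n ≤ 4 * A * t * count (class a′ j))
  split-state {n} {d} {A = A} {t} {R} {N} {E′} {Γ} {a} {b} sc N≤R 8E′≤N st i S (medium@(S⊆Aᵢ , lower , _) , poor) =
    -- The factor 8 lost in `cross-splitOff` is the one provided by `8 * E′ ≤ N`.
    *-cancelˡ-≤ 8 (begin
      8 * (X′ * E′)   ≡⟨ lemma X′ E′ ⟩
      8 * E′ * X′     ≤⟨ *-monoˡ-≤ X′ 8E′≤N ⟩
      N * X′          ≤⟨ cross-splitOff Γ a b N i S d≤n S⊆Aᵢ poor few ⟩
      8 * (n * n)     ∎) ,
    -- Both `S` and the remainder of the class it leaves keep a fraction `1/t` of a class with at
    -- least `d/2` vertices.
    λ { zero    → n≤4Atx (half-degree (row-size sc st i)) (≤-trans lower (*-monoʳ-≤ t (count-mono S (class (splitOff S a) zero) (splitOff-zero a S))))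
      ; (suc j) → n≤4Atx (half-degree (row-size sc st j)) (large-splitOff a t i S t-positive medium j) }
    where
    open Scale sc
    open ≤-Reasoning
    X′ = cross Γ (splitOff S a) (splitOff (RobustNbrs Γ a b N i S) b)
    lemma : ∀ x e → 8 * (x * e) ≡ 8 * e * x
    lemma = solve-∀
    few : N * cross Γ a b ≤ n * n
    few = begin
      N * cross Γ a b        ≡⟨ *-comm N _ ⟩
      cross Γ a b * N        ≤⟨ *-monoʳ-≤ (cross Γ a b) (≤-trans N≤R (m≤m*n R R)) ⟩
      cross Γ a b * (R * R)  ≤⟨ few-cross′ sc st ⟩
      n * n                  ∎
      where instance _ = ℕ.>-nonZero R-positive

  -- Consequences for class sizes, degrees and the number of classes

  size-difference : ∀ {n d k A t R} (Γ : Biregular n d) (a b : Fin n → Fin k) → Scale n d A t R →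
    cross Γ a b * (R * R * A) ≤ n * n → ∀ i → R * count (class a i) ≤ R * count (class b i) + 2 * n
  size-difference {n} {d} {A = A} {t} {R} Γ a b sc few i = *-cancelˡ-≤ d (begin
    d * (R * x)                ≡⟨ lemma₁ d R x ⟩
    R * (d * x)                ≤⟨ *-monoʳ-≤ R (size-balance Γ a b i) ⟩
    R * (d * y + cross Γ a b)  ≡⟨ lemma₂ R d y (cross Γ a b) ⟩
    d * (R * y) + R * cross Γ a b  ≤⟨ +-monoʳ-≤ (d * (R * y)) R*cross≤ ⟩
    d * (R * y) + n * d        ≤⟨ +-monoʳ-≤ (d * (R * y)) (*-monoˡ-≤ d (m≤n*m n 2)) ⟩
    d * (R * y) + 2 * n * d    ≡⟨ lemma₃ d R y n ⟩
    d * (R * y + 2 * n)        ∎)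
    where
    open Scale sc
    open ≤-Reasoning
    instance
      _ = ℕ.>-nonZero d-positive
      _ = ℕ.>-nonZero A-positive
      _ = ℕ.>-nonZero R-positive
    x = count (class a i)
    y = count (class b i)
    lemma₁ : ∀ d R x → d * (R * x) ≡ R * (d * x)
    lemma₁ = solve-∀
    lemma₂ : ∀ R d y c → R * (d * y + c) ≡ d * (R * y) + R * c
    lemma₂ = solve-∀
    lemma₃ : ∀ d R y n → d * (R * y) + 2 * n * d ≡ d * (R * y + 2 * n)
    lemma₃ = solve-∀
    lemma₄ : ∀ A R c → A * (R * (R * c)) ≡ c * (R * R * A)
    lemma₄ = solve-∀
    lemma₅ : ∀ A n d → n * (A * d) ≡ A * (n * d)
    lemma₅ = solve-∀
    R*cross≤ : R * cross Γ a b ≤ n * d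
    -- As `n ≤ A * d`, the bound on `cross` gives even `R * R * cross ≤ n * d`; one factor `R` is
    -- given away.
    R*cross≤ = ≤-trans (m≤n*m (R * cross Γ a b) R) (*-cancelˡ-≤ A (begin
      A * (R * (R * cross Γ a b))  ≡⟨ lemma₄ A R (cross Γ a b) ⟩
      cross Γ a b * (R * R * A)    ≤⟨ few ⟩
      n * n                        ≤⟨ *-monoʳ-≤ n dense ⟩
      n * (A * d)                  ≡⟨ lemma₅ A n d ⟩
      A * (n * d)                  ∎))

  -- Summing `row-size` over the disjoint row classes, whose sizes add up to `n`, gives (v) with
  -- denominators cleared.
  classes-fit : ∀ {n d k A t R} {Γ : Biregular n d} {a b : Fin n → Fin k} → Scale n d A t R →
    State Γ A t R a b → R * (k * d) ≤ R * n + k * (2 * n)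
  classes-fit {n} {d} {k} {R = R} {a = a} sc st = begin
    R * (k * d)                                          ≡⟨ lemma R k d ⟩
    k * (R * d)                                          ≤⟨ sum-lower (row-size sc st) ⟩
    sum (λ i → R * count (class a i) + 2 * n)            ≡⟨ ∑-distrib-+ (λ i → R * count (class a i)) (λ _ → 2 * n) ⟩
    sum (λ i → R * count (class a i)) + sum {k} (λ _ → 2 * n) ≡⟨ cong₂ _+_ (sym (*-distribˡ-sum R (λ i → count (class a i)))) (sum-const k (2 * n)) ⟩
    R * sum (λ i → count (class a i)) + k * (2 * n)      ≡⟨ cong (λ s → R * s + k * (2 * n)) (sum-class-sizes a) ⟩
    R * n + k * (2 * n)                                  ∎
    where
    open ≤-Reasoning
    lemma : ∀ R k d → R * (k * d) ≡ k * (R * d)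
    lemma = solve-∀

  2n<Rd : ∀ {n d A t R} → Scale n d A t R → 2 * n < R * d
  2n<Rd {n} {d} {A} {t} {R} sc = begin-strict
    2 * n          ≤⟨ *-monoʳ-≤ 2 dense ⟩
    2 * (A * d)    <⟨ *-monoˡ-< (A * d) (s≤s (s≤s (s≤s (z≤n {1})))) ⟩
    4 * (A * d)    ≡⟨ *-assoc 4 A d ⟨
    4 * A * d      ≤⟨ *-monoˡ-≤ d 4A≤R ⟩
    R * d          ∎
    where
    open Scale sc
    open ≤-Reasoning
    instance _ = ℕ.>-nonZero (≤-trans n-positive dense)

  -- The `d` neighbours of `u` are shared among `k` column classes, and its own class holds a
  -- largest share.
  min-degree : ∀ {n d k} (Γ : Biregular n d) (a b : Fin n → Fin k) → Optimal Γ a b →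
    ∀ u → d ≤ k * deg Γ u b (a u)
  min-degree Γ a b optimal u = ≤-trans (≤-reflexive (sym (sum-deg Γ u b))) (sum-upper (optimal u))

open Bipartite
open import Data.Integer as ℤ using (+_; +[1+_])
import Data.Integer.Properties as ℤ
open import Data.Rational using (ℚ; mkℚ; *<*; _/_; _≤_; _<_; _≤ᵇ_; _+_; _*_; _-_; -_; 0ℚ; 1ℚ; toℚᵘ; NonNegative; Positive; nonNegative; positive)
open import Data.Rational.Properties hiding (_≟_)
open import Data.Rational.Unnormalised as ℚᵘ using (mkℚᵘ; *≡*; *≤*)
import Data.Rational.Unnormalised.Properties as ℚᵘ

-- Rational arithmetic with unit fractions

toℚᵘ-toℚ : ∀ m → toℚᵘ (toℚ m) ℚᵘ.≃ mkℚᵘ (+ m) 0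
toℚᵘ-toℚ m = toℚᵘ-fromℚᵘ (mkℚᵘ (+ m) 0)

toℚ-+ : ∀ m n → toℚ (m ℕ.+ n) ≡ toℚ m + toℚ n
toℚ-+ m n = toℚᵘ-injective (begin
  toℚᵘ (toℚ (m ℕ.+ n))               ≈⟨ toℚᵘ-toℚ (m ℕ.+ n) ⟩
  mkℚᵘ (+ (m ℕ.+ n)) 0               ≈⟨ *≡* (cong (ℤ._* + 1) (cong₂ ℤ._+_ (ℤ.*-identityʳ (+ m)) (ℤ.*-identityʳ (+ n)))) ⟨
  mkℚᵘ (+ m) 0 ℚᵘ.+ mkℚᵘ (+ n) 0     ≈⟨ ℚᵘ.+-cong (toℚᵘ-toℚ m) (toℚᵘ-toℚ n) ⟨
  toℚᵘ (toℚ m) ℚᵘ.+ toℚᵘ (toℚ n)     ≈⟨ toℚᵘ-homo-+ (toℚ m) (toℚ n) ⟨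
  toℚᵘ (toℚ m + toℚ n)               ∎)
  where open ℚᵘ.≃-Reasoning

toℚ-* : ∀ m n → toℚ (m ℕ.* n) ≡ toℚ m * toℚ n
toℚ-* m n = toℚᵘ-injective (begin
  toℚᵘ (toℚ (m ℕ.* n))               ≈⟨ toℚᵘ-toℚ (m ℕ.* n) ⟩
  mkℚᵘ (+ (m ℕ.* n)) 0               ≈⟨ *≡* (cong (ℤ._* + 1) (ℤ.pos-* m n)) ⟩
  mkℚᵘ (+ m) 0 ℚᵘ.* mkℚᵘ (+ n) 0     ≈⟨ ℚᵘ.*-cong (toℚᵘ-toℚ m) (toℚᵘ-toℚ n) ⟨
  toℚᵘ (toℚ m) ℚᵘ.* toℚᵘ (toℚ n)     ≈⟨ toℚᵘ-homo-* (toℚ m) (toℚ n) ⟨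
  toℚᵘ (toℚ m * toℚ n)               ∎)
  where open ℚᵘ.≃-Reasoning

toℚ-mono-≤ : ∀ {m n} → m ℕ.≤ n → toℚ m ≤ toℚ n
toℚ-mono-≤ {m} {n} m≤n = toℚᵘ-cancel-≤ (begin
  toℚᵘ (toℚ m)  ≃⟨ toℚᵘ-toℚ m ⟩
  mkℚᵘ (+ m) 0  ≤⟨ *≤* (ℤ.*-monoʳ-≤-nonNeg (+ 1) (ℤ.+≤+ m≤n)) ⟩
  mkℚᵘ (+ n) 0  ≃⟨ toℚᵘ-toℚ n ⟨
  toℚᵘ (toℚ n)  ∎)
  where open ℚᵘ.≤-Reasoning

toℚ-mono-< : ∀ {m n} → m ℕ.< n → toℚ m < toℚ n
toℚ-mono-< {m} {n} m<n = toℚᵘ-cancel-< (begin-strict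
  toℚᵘ (toℚ m)  ≃⟨ toℚᵘ-toℚ m ⟩
  mkℚᵘ (+ m) 0  <⟨ ℚᵘ.*<* (ℤ.*-monoʳ-<-pos (+ 1) (ℤ.+<+ m<n)) ⟩
  mkℚᵘ (+ n) 0  ≃⟨ toℚᵘ-toℚ n ⟨
  toℚᵘ (toℚ n)  ∎)
  where open ℚᵘ.≤-Reasoning

toℚ-cancel-≤ : ∀ {m n} → toℚ m ≤ toℚ n → m ℕ.≤ n
toℚ-cancel-≤ {m} {n} h = ℕ.≮⇒≥ λ n<m → <-irrefl refl (<-≤-trans (toℚ-mono-< n<m) h)

toℚ-nonNeg : ∀ m → NonNegative (toℚ m)
toℚ-nonNeg m = nonNegative (toℚ-mono-≤ {0} {m} ℕ.z≤n)

toℚ-pos : ∀ m .{{_ : ℕ.NonZero m}} → Positive (toℚ m)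
toℚ-pos (suc m) = positive (toℚ-mono-< {0} {suc m} (ℕ.s≤s ℕ.z≤n))

-- Opaque, since conversion checking would otherwise unfold the gcd computations inside _/_.
opaque
  unit : ∀ m .{{_ : ℕ.NonZero m}} → ℚ
  unit m = + 1 / m

  unit-inverse : ∀ m .{{_ : ℕ.NonZero m}} → unit m * toℚ m ≡ 1ℚ
  unit-inverse m@(suc m-1) = toℚᵘ-injective (begin
    toℚᵘ (unit m * toℚ m)              ≈⟨ toℚᵘ-homo-* (unit m) (toℚ m) ⟩
    toℚᵘ (unit m) ℚᵘ.* toℚᵘ (toℚ m)    ≈⟨ ℚᵘ.*-cong (toℚᵘ-fromℚᵘ (mkℚᵘ (+ 1) m-1)) (toℚᵘ-toℚ m) ⟩
    mkℚᵘ (+ 1) m-1 ℚᵘ.* mkℚᵘ (+ m) 0   ≈⟨ *≡* (cong +_ lemma) ⟩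
    ℚᵘ.1ℚᵘ                             ∎)
    where
    open ℚᵘ.≃-Reasoning
    lemma : (1 ℕ.* m) ℕ.* 1 ≡ 1 ℕ.* (m ℕ.* 1)
    lemma = ℕ.*-assoc 1 m 1

unit>0 : ∀ m .{{_ : ℕ.NonZero m}} → 0ℚ < unit m
unit>0 m = *-cancelʳ-<-nonNeg (toℚ m) (begin-strict
  0ℚ * toℚ m      ≡⟨ *-zeroˡ (toℚ m) ⟩
  0ℚ              <⟨ positive⁻¹ 1ℚ ⟩
  1ℚ              ≡⟨ unit-inverse m ⟨
  unit m * toℚ m  ∎)
  where
  open ≤-Reasoning
  instance _ = toℚ-nonNeg m

unit≤⇒1≤ : ∀ m .{{_ : ℕ.NonZero m}} {q} → unit m ≤ q → 1ℚ ≤ q * toℚ m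
unit≤⇒1≤ m {q} h = subst (_≤ q * toℚ m) (unit-inverse m) (*-monoʳ-≤-nonNeg (toℚ m) h)
  where instance _ = toℚ-nonNeg m

1≤⇒unit≤ : ∀ m .{{_ : ℕ.NonZero m}} {q} → 1ℚ ≤ q * toℚ m → unit m ≤ q
1≤⇒unit≤ m {q} h = *-cancelʳ-≤-pos (toℚ m) (subst (_≤ q * toℚ m) (sym (unit-inverse m)) h)
  where instance _ = toℚ-pos m

1≤*-mono : ∀ {q} m n → 0ℚ < q → m ℕ.≤ n → 1ℚ ≤ q * toℚ m → 1ℚ ≤ q * toℚ n
1≤*-mono {q} m n 0<q m≤n h = ≤-trans h (*-monoˡ-≤-nonNeg q (toℚ-mono-≤ {m} {n} m≤n))
  where instance _ = nonNegative (<⇒≤ 0<q)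

opaque
  unfolding unit

  -- The denominator of `q` serves as `m`, since the numerator is at least 1.
  archimedean : ∀ q → 0ℚ < q → ∃[ m ] (ℕ.NonZero m × 1ℚ ≤ q * toℚ m)
  archimedean q@(mkℚ +[1+ p ] d-1 _) 0<q = suc d-1 , _ , unit≤⇒1≤ (suc d-1) (toℚᵘ-cancel-≤ (begin
    toℚᵘ (unit (suc d-1))    ≃⟨ toℚᵘ-fromℚᵘ (mkℚᵘ (+ 1) d-1) ⟩
    mkℚᵘ (+ 1) d-1           ≤⟨ *≤* (ℤ.*-monoʳ-≤-nonNeg (+ suc d-1) (ℤ.+≤+ (ℕ.s≤s (ℕ.z≤n {p})))) ⟩
    mkℚᵘ +[1+ p ] d-1        ∎))
    where open ℚᵘ.≤-Reasoning
  archimedean (mkℚ (+ 0) _ _) (*<* (ℤ.+<+ ()))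
  archimedean (mkℚ ℤ.-[1+ _ ] _ _) (*<* ())

-- The bridge between the two settings: multiplying by `N` clears the unit fraction, so that
-- inequalities involving `ν` and `ρ` become inequalities of naturals.
scaled : ∀ N .{{_ : ℕ.NonZero N}} s M → (toℚ s + unit N * toℚ M) * toℚ N ≡ toℚ (N ℕ.* s ℕ.+ M)
scaled N s M = begin
  (toℚ s + unit N * toℚ M) * toℚ N              ≡⟨ lemma (toℚ s) (unit N) (toℚ M) (toℚ N) ⟩
  toℚ N * toℚ s + unit N * toℚ N * toℚ M        ≡⟨ cong (λ x → toℚ N * toℚ s + x * toℚ M) (unit-inverse N) ⟩
  toℚ N * toℚ s + 1ℚ * toℚ M                    ≡⟨ cong₂ _+_ (sym (toℚ-* N s)) (*-identityˡ (toℚ M)) ⟩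
  toℚ (N ℕ.* s) + toℚ M                         ≡⟨ toℚ-+ (N ℕ.* s) M ⟨
  toℚ (N ℕ.* s ℕ.+ M)                           ∎
  where
  open ≡-Reasoning
  lemma : ∀ s u m r → (s + u * m) * r ≡ r * s + u * r * m
  lemma = solve 4 (λ s u m r → (s :+ u :* m) :* r := r :* s :+ u :* r :* m) refl
    where open +-*-Solver

scaled₀ : ∀ N r → toℚ r * toℚ N ≡ toℚ (N ℕ.* r)
scaled₀ N r = trans (*-comm (toℚ r) (toℚ N)) (sym (toℚ-* N r))

≤-unscale : ∀ N .{{_ : ℕ.NonZero N}} s M r → N ℕ.* s ℕ.+ M ℕ.≤ N ℕ.* r → toℚ s + unit N * toℚ M ≤ toℚ r
≤-unscale N s M r h = *-cancelʳ-≤-pos (toℚ N)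
  (subst₂ _≤_ (sym (scaled N s M)) (sym (scaled₀ N r)) (toℚ-mono-≤ h))
  where instance _ = toℚ-pos N

≤-scale : ∀ N .{{_ : ℕ.NonZero N}} s M r → toℚ s + unit N * toℚ M ≤ toℚ r → N ℕ.* s ℕ.+ M ℕ.≤ N ℕ.* r
≤-scale N s M r h = toℚ-cancel-≤
  (subst₂ _≤_ (scaled N s M) (scaled₀ N r) (*-monoʳ-≤-nonNeg (toℚ N) h))
  where instance _ = toℚ-nonNeg N

≤-unscaleʳ : ∀ N .{{_ : ℕ.NonZero N}} s M r → N ℕ.* r ℕ.≤ N ℕ.* s ℕ.+ M → toℚ r ≤ toℚ s + unit N * toℚ M
≤-unscaleʳ N s M r h = *-cancelʳ-≤-pos (toℚ N)
  (subst₂ _≤_ (sym (scaled₀ N r)) (sym (scaled N s M)) (toℚ-mono-≤ h))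
  where instance _ = toℚ-pos N

<-unscale : ∀ N .{{_ : ℕ.NonZero N}} s M r → N ℕ.* s ℕ.+ M ℕ.< N ℕ.* r → toℚ s + unit N * toℚ M < toℚ r
<-unscale N s M r h = *-cancelʳ-<-nonNeg (toℚ N)
  (subst₂ _<_ (sym (scaled N s M)) (sym (scaled₀ N r)) (toℚ-mono-< h))
  where instance _ = toℚ-nonNeg N

toℚ0+ : ∀ x → toℚ 0 + x ≡ x
toℚ0+ = +-identityˡ

≤-unscale₀ : ∀ N .{{_ : ℕ.NonZero N}} M r → M ℕ.≤ N ℕ.* r → unit N * toℚ M ≤ toℚ r
≤-unscale₀ N M r h = subst (_≤ toℚ r) (toℚ0+ (unit N * toℚ M))
  (≤-unscale N 0 M r (subst (λ z → z ℕ.+ M ℕ.≤ N ℕ.* r) (sym (ℕ.*-zeroʳ N)) h))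

≤-scale₀ : ∀ N .{{_ : ℕ.NonZero N}} M r → unit N * toℚ M ≤ toℚ r → M ℕ.≤ N ℕ.* r
≤-scale₀ N M r h = ℕ.≤-trans (ℕ.m≤n+m M (N ℕ.* 0))
  (≤-scale N 0 M r (subst (_≤ toℚ r) (sym (toℚ0+ (unit N * toℚ M))) h))

≤-unscaleʳ₀ : ∀ N .{{_ : ℕ.NonZero N}} M r → N ℕ.* r ℕ.≤ M → toℚ r ≤ unit N * toℚ M
≤-unscaleʳ₀ N M r h = subst (toℚ r ≤_) (toℚ0+ (unit N * toℚ M))
  (≤-unscaleʳ N 0 M r (ℕ.≤-trans h (ℕ.m≤n+m M (N ℕ.* 0))))

<-unscale₀ : ∀ N .{{_ : ℕ.NonZero N}} M r → M ℕ.< N ℕ.* r → unit N * toℚ M < toℚ r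
<-unscale₀ N M r h = subst (_< toℚ r) (toℚ0+ (unit N * toℚ M))
  (<-unscale N 0 M r (subst (λ z → z ℕ.+ M ℕ.< N ℕ.* r) (sym (ℕ.*-zeroʳ N)) h))

p≤q+r⇒p-r≤q : ∀ p q r → p ≤ q + r → p - r ≤ q
p≤q+r⇒p-r≤q p q r h = subst (p - r ≤_) (lemma q r) (+-monoˡ-≤ (- r) h)
  where
  lemma : ∀ q r → q + r - r ≡ q
  lemma = solve 2 (λ q r → q :+ r :- r := q) refl where open +-*-Solver

p<q⇒0<q-p : ∀ {p q} → p < q → 0ℚ < q - p
p<q⇒0<q-p {p} {q} h = subst (_< q - p) (+-inverseʳ p) (+-monoˡ-< (- p) h)

2ρn : ∀ R .{{_ : ℕ.NonZero R}} n → toℚ 2 * unit R * toℚ n ≡ unit R * toℚ (2 ℕ.* n)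
2ρn R n = trans (lemma (toℚ 2) (unit R) (toℚ n)) (cong (unit R *_) (sym (toℚ-* 2 n)))
  where
  lemma : ∀ t u n → t * u * n ≡ u * (t * n)
  lemma = solve 3 (λ t u n → t :* u :* n := u :* (t :* n)) refl where open +-*-Solver

-- Choice of the constants

-- What a successful run delivers, still in integers, with `ρ = 1/R` and `ν = 1/N`. There are
-- `suc k` classes, so their number is positive.
record Outcome (f : ℚ → ℚ) (n₀ A t : ℕ) {n d : ℕ} (Γ : Biregular n d) : Set where
  field
    N R k     : ℕ
    {{N≢0}}   : ℕ.NonZero N
    {{R≢0}}   : ℕ.NonZero R
    t≤N       : t ℕ.≤ N
    1<N       : 1 ℕ.< N
    N≤R       : N ℕ.≤ R
    R≤n₀      : R ℕ.≤ n₀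
    ρ≤fν      : unit R ≤ f (unit N)
    1≤fρ      : 1ℚ ≤ f (unit R) * toℚ n₀
    row col   : Fin n → Fin (suc k)
    scale     : Scale n d A t R
    partition : State Γ A t R row col
    rows-opt  : Optimal Γ row col
    cols-opt  : Optimal (transpose Γ) col row
    expands   : Expands Γ row col N t

unit<1 : ∀ m .{{_ : ℕ.NonZero m}} → 1 ℕ.< m → unit m < 1ℚ
unit<1 m 1<m = subst (_< 1ℚ) (*-identityʳ (unit m)) (<-unscale₀ m 1 1 (subst (1 ℕ.<_) (sym (ℕ.*-identityʳ m)) 1<m))

unit-anti : ∀ m n .{{_ : ℕ.NonZero m}} .{{_ : ℕ.NonZero n}} → m ℕ.≤ n → unit n ≤ unit m
unit-anti m n m≤n = 1≤⇒unit≤ n (1≤*-mono m n (unit>0 m) m≤n (unit≤⇒1≤ m ≤-refl))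

-- m is the number of further splits that the bound k ≤ 2A still permits.
Reaches : (f : ℚ → ℚ) (A t m E n₁ : ℕ) → Set
Reaches f A t m E n₁ = ∀ {n₀ n d k} → n₁ ℕ.≤ n₀ → n₀ ℕ.≤ n → (Γ : Biregular n d) →
  n ℕ.≤ A ℕ.* d → d ℕ.≤ n → (a b : Fin n → Fin (suc k)) → cross Γ a b ℕ.* E ℕ.≤ n ℕ.* n →
  (∀ i → n ℕ.≤ 4 ℕ.* A ℕ.* t ℕ.* count (class a i)) → 2 ℕ.* A ℕ.< suc k ℕ.+ m → Outcome f n₀ A t Γ

-- Constants of one stage, given `E′` and `n₁` of the next: `8 * E′ ≤ N` lets a failed expansion be
-- handed on, `1 < N` puts `ν` in the domain of `f`, and `n₂` is a lower bound for the admissible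
-- `n₀`.
record Constants (f : ℚ → ℚ) (A t E′ n₁ : ℕ) : Set where
  field
    N R n₂   : ℕ
    {{N≢0}}  : ℕ.NonZero N
    {{R≢0}}  : ℕ.NonZero R
    t≤N      : t ℕ.≤ N
    1<N      : 1 ℕ.< N
    8E′≤N    : 8 ℕ.* E′ ℕ.≤ N
    N≤R      : N ℕ.≤ R
    4At≤R    : 4 ℕ.* A ℕ.* t ℕ.≤ R
    R≤n₂     : R ℕ.≤ n₂
    n₁≤n₂    : n₁ ℕ.≤ n₂
    4A<n₂    : 4 ℕ.* A ℕ.< n₂
    ρ≤fν     : unit R ≤ f (unit N)
    fρ>0     : 0ℚ < f (unit R)
    1≤fρ     : 1ℚ ≤ f (unit R) * toℚ n₂

upper-bound : ∀ a b c d → ∃[ m ] (a ℕ.≤ m × b ℕ.≤ m × c ℕ.≤ m × d ℕ.≤ m)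
upper-bound a b c d = a ℕ.+ (b ℕ.+ (c ℕ.+ d)) , ℕ.m≤m+n a _ , ℕ.m≤n⇒m≤o+n a (ℕ.m≤m+n b _) ,
  ℕ.m≤n⇒m≤o+n a (ℕ.m≤n⇒m≤o+n b (ℕ.m≤m+n c d)) , ℕ.m≤n⇒m≤o+n a (ℕ.m≤n⇒m≤o+n b (ℕ.m≤n+m d c))

-- The choices are made in the order `N`, `R`, `n₂`, as `R` depends on the value of `f` at `1/N` and
-- `n₂` on its value at `1/R`. Both values are positive, so `archimedean` applies to them.
constants : ∀ f A t E′ n₁ → MapsUnitInterval f → Constants f A t E′ n₁
-- The 2 keeps `1/N` below 1; the 0 pads the list to four entries.
constants f A t E′ n₁ f∈ = chooseN (upper-bound 2 t (8 ℕ.* E′) 0)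
  where
  value>0 : ∀ N .{{_ : ℕ.NonZero N}} → 1 ℕ.< N → 0ℚ < f (unit N)
  value>0 N 1<N = proj₁ (f∈ (unit N) (unit>0 N) (unit<1 N 1<N))

  choose-n₂ : ∀ N R {{_ : ℕ.NonZero N}} {{_ : ℕ.NonZero R}} → 1 ℕ.< N → t ℕ.≤ N → 8 ℕ.* E′ ℕ.≤ N →
    N ℕ.≤ R → 4 ℕ.* A ℕ.* t ℕ.≤ R → unit R ≤ f (unit N) → 0ℚ < f (unit R) →
    ∀ s → 1ℚ ≤ f (unit R) * toℚ s →
    ∃[ n₂ ] (R ℕ.≤ n₂ × n₁ ℕ.≤ n₂ × 4 ℕ.* A ℕ.< n₂ × s ℕ.≤ n₂) → Constants f A t E′ n₁
  choose-n₂ N R 1<N t≤N 8E′≤N N≤R 4At≤R ρ≤fν fρ>0 s 1≤fρ (n₂ , R≤n₂ , n₁≤n₂ , 4A<n₂ , s≤n₂) = record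
    { N = N ; R = R ; n₂ = n₂ ; t≤N = t≤N ; 1<N = 1<N ; 8E′≤N = 8E′≤N ; N≤R = N≤R ; 4At≤R = 4At≤R
    ; R≤n₂ = R≤n₂ ; n₁≤n₂ = n₁≤n₂ ; 4A<n₂ = 4A<n₂ ; ρ≤fν = ρ≤fν ; fρ>0 = fρ>0
    ; 1≤fρ = 1≤*-mono s n₂ fρ>0 s≤n₂ 1≤fρ }

  chooseR : ∀ N {{_ : ℕ.NonZero N}} → 1 ℕ.< N → t ℕ.≤ N → 8 ℕ.* E′ ℕ.≤ N →
    ∀ r → 1ℚ ≤ f (unit N) * toℚ r →
    ∃[ R ] (N ℕ.≤ R × 4 ℕ.* A ℕ.* t ℕ.≤ R × r ℕ.≤ R × 0 ℕ.≤ R) → Constants f A t E′ n₁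
  chooseR N 1<N t≤N 8E′≤N r 1≤fν (R , N≤R , 4At≤R , r≤R , _) =
    let instance _ = ℕ.>-nonZero (ℕ.≤-trans (ℕ.<⇒≤ 1<N) N≤R)
        fρ>0 = value>0 R (ℕ.≤-trans 1<N N≤R)
        (s , _ , 1≤fρ) = archimedean (f (unit R)) fρ>0
    in choose-n₂ N R 1<N t≤N 8E′≤N N≤R 4At≤R (1≤⇒unit≤ R (1≤*-mono r R (value>0 N 1<N) r≤R 1≤fν)) fρ>0
         s 1≤fρ (upper-bound R n₁ (suc (4 ℕ.* A)) s)

  chooseN : ∃[ N ] (2 ℕ.≤ N × t ℕ.≤ N × 8 ℕ.* E′ ℕ.≤ N × 0 ℕ.≤ N) → Constants f A t E′ n₁
  chooseN (N , 1<N , t≤N , 8E′≤N , _) =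
    let instance _ = ℕ.>-nonZero (ℕ.<⇒≤ 1<N)
        (r , _ , 1≤fν) = archimedean (f (unit N)) (value>0 N 1<N)
    in chooseR N 1<N t≤N 8E′≤N r 1≤fν (upper-bound N (4 ℕ.* A ℕ.* t) r 0)

-- With no split left, `suc k` exceeds `2 * A`, contrary to `number-of-classes`.
reaches-zero : ∀ {f A t} → 0 ℕ.< A → 0 ℕ.< t → ∀ R → 4 ℕ.* A ℕ.* t ℕ.≤ R →
  Reaches f A t 0 (R ℕ.* R ℕ.* A) (suc (4 ℕ.* A))
reaches-zero {f} {A} {t} 0<A 0<t R R-large {n₀} {n} {d} {k} n₁≤n₀ n₀≤n Γ dense d≤n a b few large k-large =
  contradiction (subst (2 ℕ.* A ℕ.<_) (ℕ.+-identityʳ (suc k)) k-large) (ℕ.≤⇒≯ (number-of-classes sc st))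
  where
  n₁≤n = ℕ.≤-trans n₁≤n₀ n₀≤n
  sc : Scale n d A t R
  sc = record { n-positive = ℕ.≤-trans (ℕ.s≤s ℕ.z≤n) n₁≤n ; A-positive = 0<A ; t-positive = 0<t
              ; dense = dense ; d≤n = d≤n ; n-large = ℕ.<⇒≤ n₁≤n ; R-large = R-large }
  st : State Γ A t R a b
  st = state few large

-- The partition is settled by moves. If it then expands, the constants of this stage serve;
-- otherwise one split leads to the next stage.
reaches-suc : ∀ {f A t m E′ n₁} → 0 ℕ.< A → 0 ℕ.< t → (c : Constants f A t E′ n₁) →
  Reaches f A t m E′ n₁ →
  Reaches f A t (suc m) (Constants.R c ℕ.* Constants.R c ℕ.* A) (Constants.n₂ c)
reaches-suc {f} {A} {t} {m} {E′} {n₁} 0<A 0<t c continue {n₀} {n} {d} {k} n₂≤n₀ n₀≤n Γ dense d≤n a₀ b₀ few lrg k-large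
  = conclude (settle Γ a₀ b₀ sc (state few lrg) (<-wellFounded (cross Γ a₀ b₀)))
  where
  open Constants c
  4A<n : 4 ℕ.* A ℕ.< n
  4A<n = ℕ.≤-trans 4A<n₂ (ℕ.≤-trans n₂≤n₀ n₀≤n)
  sc : Scale n d A t R
  sc = record { n-positive = ℕ.≤-trans (ℕ.s≤s ℕ.z≤n) 4A<n ; A-positive = 0<A ; t-positive = 0<t
              ; dense = dense ; d≤n = d≤n ; n-large = ℕ.<⇒≤ 4A<n ; R-large = 4At≤R }
  finish : (a b : Fin n → Fin (suc k)) → State Γ A t R a b → Optimal Γ a b → Optimal (transpose Γ) b a →
    Expands Γ a b N t → Outcome f n₀ A t Γ
  finish a b st rows cols expands = record
    { N = N ; R = R ; t≤N = t≤N ; 1<N = 1<N ; N≤R = N≤R ; R≤n₀ = ℕ.≤-trans R≤n₂ n₂≤n₀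
    ; ρ≤fν = ρ≤fν ; 1≤fρ = 1≤*-mono n₂ n₀ fρ>0 n₂≤n₀ 1≤fρ ; row = a ; col = b
    ; scale = sc ; partition = st ; rows-opt = rows ; cols-opt = cols ; expands = expands }

  split : (a b : Fin n → Fin (suc k)) → State Γ A t R a b → ∀ i S → Violates Γ a b N t i S → Outcome f n₀ A t Γ
  split a b st i S viol = continue (ℕ.≤-trans n₁≤n₂ n₂≤n₀) n₀≤n Γ dense d≤n
    (splitOff S a) (splitOff (RobustNbrs Γ a b N i S) b) (proj₁ next) (proj₂ next)
    -- The new class uses up one of the remaining splits: `suc k + suc m` equals `suc (suc k) + m`.
    (subst (2 ℕ.* A ℕ.<_) (ℕ.+-suc (suc k) m) k-large)
    where next = split-state sc N≤R 8E′≤N st i S viol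

  conclude : ∃[ a ] ∃[ b ] (State {k = suc k} Γ A t R a b × Optimal Γ a b × Optimal (transpose Γ) b a) →
    Outcome f n₀ A t Γ
  conclude (a , b , st , rows , cols) with expands? Γ a b N t
  ... | inj₁ expands        = finish a b st rows cols expands
  ... | inj₂ (i , S , viol) = split a b st i S viol

-- The recursion builds the stages from the last one backwards; the `E` of a stage is its own
-- `R * R * A`, as in `few-cross`.
reaches : ∀ f A t → 0 ℕ.< A → 0 ℕ.< t → MapsUnitInterval f → ∀ m → ∃[ E ] ∃[ n₁ ] Reaches f A t m E n₁
reaches f A t 0<A 0<t f∈ zero = _ , _ , reaches-zero 0<A 0<t (4 ℕ.* A ℕ.* t) ℕ.≤-refl
reaches f A t 0<A 0<t f∈ (suc m) with reaches f A t 0<A 0<t f∈ m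
... | E′ , n₁ , ih = _ , _ , reaches-suc 0<A 0<t (constants f A t E′ n₁ f∈) ih

-- Return to digraphs and rational constants

≤⇒≤ᵇ-true : ∀ {p q} → p ≤ q → (p ≤ᵇ q) ≡ true
≤⇒≤ᵇ-true p≤q = Equivalence.to T-≡ (≤⇒≤ᵇ p≤q)

biregular : ∀ {n d} (G : Digraph n) → Regular G d → Biregular n d
biregular {n} {d} G reg = record
  { adj         = E G
  ; out-regular = λ u → trans (count-cong (E G u) (λ w → E G u w ∧ true) (λ w → sym (∧-identityʳ (E G u w)))) (proj₁ (reg u))
  ; in-regular  = λ w → trans (count-cong (λ u → E G u w) (λ u → E G u w ∧ true) (λ u → sym (∧-identityʳ (E G u w)))) (proj₂ (reg w))
  }

cross-single : ∀ {n d} (Γ : Biregular n d) → cross {k = 1} Γ (λ _ → zero) (λ _ → zero) ≡ 0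
cross-single {n} Γ = ℕ.n≤0⇒n≡0 (ℕ.≤-trans (sum-upper {n} {c = 0} λ u → ℕ.≤-reflexive
  (trans (count-cong (λ w → adj Γ u w ∧ false) (λ _ → false) (λ w → ∧-zeroʳ (adj Γ u w))) (count-false n)))
  (ℕ.≤-reflexive (ℕ.*-zeroʳ n)))

bip-expander : ∀ {n d k t N τ} (G : Digraph n) (reg : Regular G d) (a b : Fin n → Fin k)
  .{{_ : ℕ.NonZero t}} .{{_ : ℕ.NonZero N}} → unit t ≤ τ → Expands (biregular G reg) a b N t →
  ∀ i → BipRobustExpander G (class a i) (class b i) (unit N) τ
bip-expander {n} {t = t} {N} {τ} G reg a b t≤τ expands i S S⊆U lower upper =
  ≤-unscale N s M (RNcount G U W S (unit N))
    (ℕ.≤-trans (expands i S (S⊆U , lowerℕ , upperℕ)) (ℕ.*-monoʳ-≤ N (count-mono RN RN′ RN⊆)))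
  where
  U = class a i
  W = class b i
  s = count S
  M = count U ℕ.+ count W
  RN = RobustNbrs (biregular G reg) a b N i S
  RN′ : VSet n
  RN′ w = W w ∧ ((unit N * toℚ M) ≤ᵇ toℚ (count (λ u → S u ∧ E G u w)))

  unit*≤τ* : unit t * toℚ (count U) ≤ τ * toℚ (count U)
  unit*≤τ* = *-monoʳ-≤-nonNeg (toℚ (count U)) t≤τ
    where instance _ = toℚ-nonNeg (count U)

  lowerℕ : count U ℕ.≤ t ℕ.* s
  lowerℕ = ≤-scale₀ t (count U) s (≤-trans unit*≤τ* lower)

  upperℕ : t ℕ.* s ℕ.+ count U ℕ.≤ t ℕ.* count U
  upperℕ = ≤-scale t s (count U) (count U) (begin
    -- The added `1/t` of the class size is at most the `τ` of it that the bound on `S` leaves free.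
    toℚ s + unit t * toℚ (count U)                        ≤⟨ +-mono-≤ upper unit*≤τ* ⟩
    (1ℚ - τ) * toℚ (count U) + τ * toℚ (count U)          ≡⟨ lemma τ (toℚ (count U)) ⟩
    toℚ (count U)                                         ∎)
    where
    open ≤-Reasoning
    lemma : ∀ τ u → (1ℚ - τ) * u + τ * u ≡ u
    lemma = solve 2 (λ τ u → (con 1ℚ :- τ) :* u :+ τ :* u := u) refl where open +-*-Solver

  RN⊆ : RN ⊆ˢ RN′
  RN⊆ w w∈RN = ∧-intro (proj₁ parts) (≤⇒≤ᵇ-true
    (≤-unscale₀ N M c (⌊⌋-true (M ℕ.≤? N ℕ.* c) (proj₂ parts))))
    where
    parts = ∧-true {W w} w∈RN
    c = count (λ u → S u ∧ E G u w)

-- A vertex that is not bad has at most `2ρn` foreign edges, and its other edges end in its own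
-- class.
nearly-full-degree : ∀ {n d k} R .{{_ : ℕ.NonZero R}} (Γ : Biregular n d) (a b : Fin n → Fin k) u {i} → a u ≡ i →
  bad Γ a b R u ≡ false → toℚ d - toℚ 2 * unit R * toℚ n ≤ toℚ (deg Γ u b i)
nearly-full-degree {n} {d} R Γ a b u refl good = p≤q+r⇒p-r≤q (toℚ d) (toℚ D) (toℚ 2 * unit R * toℚ n)
  (subst (λ e → toℚ d ≤ toℚ D + e) (sym (2ρn R n)) (≤-unscaleʳ R D (2 ℕ.* n) d (begin
    R ℕ.* d                               ≡⟨ cong (R ℕ.*_) (deg+foreign Γ a b u) ⟨
    R ℕ.* (D ℕ.+ foreign Γ a b u)         ≡⟨ ℕ.*-distribˡ-+ R D _ ⟩
    R ℕ.* D ℕ.+ R ℕ.* foreign Γ a b u     ≤⟨ ℕ.+-monoʳ-≤ (R ℕ.* D) (ℕ.≮⇒≥ (⌊⌋-false (2 ℕ.* n ℕ.<? R ℕ.* foreign Γ a b u) good)) ⟩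
    R ℕ.* D ℕ.+ 2 ℕ.* n                   ∎)))
  where
  open ℕ.≤-Reasoning
  D = deg Γ u b (a u)

one-of : ∀ p q {x y} → not (x ∧ y) ≡ true → (p ≡ false → x ≡ true) → (q ≡ false → y ≡ true) →
  p ≡ true ⊎ q ≡ true
one-of true  q     h p⇒ q⇒ = inj₁ refl
one-of false true  h p⇒ q⇒ = inj₂ refl
one-of false false h p⇒ q⇒ = contradiction (trans (sym h) (cong not (cong₂ _∧_ (p⇒ refl) (q⇒ refl)))) λ ()

-- An exceptional vertex is bad for its out-edges or for its in-edges, and `few-bad` allows at most
-- `ρn/2` of each kind.
few-exceptional : ∀ {n d k A t R} .{{_ : ℕ.NonZero R}} (Γ : Biregular n d) (a b : Fin n → Fin k) →
  Scale n d A t R → State Γ A t R a b → ∀ i j →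
  toℚ (count (λ x → (class a i x ∧ class b j x) ∧
      not (((toℚ d - toℚ 2 * unit R * toℚ n) ≤ᵇ toℚ (deg Γ x b i))
         ∧ ((toℚ d - toℚ 2 * unit R * toℚ n) ≤ᵇ toℚ (deg (transpose Γ) x a j)))))
    ≤ toℚ 2 * unit R * toℚ n
few-exceptional {n} {d} {R = R} Γ a b sc st i j = begin
  toℚ (count exceptional)             ≤⟨ ≤-unscaleʳ₀ R (2 ℕ.* n) (count exceptional) few ⟩
  unit R * toℚ (2 ℕ.* n)              ≡⟨ 2ρn R n ⟨
  toℚ 2 * unit R * toℚ n              ∎
  where
  open ≤-Reasoning
  δ = toℚ d - toℚ 2 * unit R * toℚ n
  exceptional badRow badCol : VSet n
  exceptional x = (class a i x ∧ class b j x) ∧ not ((δ ≤ᵇ toℚ (deg Γ x b i)) ∧ (δ ≤ᵇ toℚ (deg (transpose Γ) x a j)))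
  badRow = bad Γ a b R
  badCol = bad (transpose Γ) b a R

  covers : ∀ x → exceptional x ≡ true → badRow x ≡ true ⊎ badCol x ≡ true
  covers x x∈ = one-of (badRow x) (badCol x) (proj₂ parts)
    (λ row → ≤⇒≤ᵇ-true (nearly-full-degree R Γ a b x (⌊⌋-true (a x ≟ i) (proj₁ classes)) row))
    (λ col → ≤⇒≤ᵇ-true (nearly-full-degree R (transpose Γ) b a x (⌊⌋-true (b x ≟ j) (proj₂ classes)) col))
    where
    parts = ∧-true {class a i x ∧ class b j x} x∈
    classes = ∧-true {class a i x} (proj₁ parts)

  few : R ℕ.* count exceptional ℕ.≤ 2 ℕ.* n
  few = ℕ.*-cancelˡ-≤ 2 few₂
    where
    open Scale sc
    few₂ : 2 ℕ.* (R ℕ.* count exceptional) ℕ.≤ 2 ℕ.* (2 ℕ.* n)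
    few₂ = ℕ.≤-trans (ℕ.≤-reflexive (sym (ℕ.*-assoc 2 R _)))
      (ℕ.≤-trans (ℕ.*-monoʳ-≤ (2 ℕ.* R) (count-union exceptional badRow badCol covers))
      (ℕ.≤-trans (ℕ.≤-reflexive (ℕ.*-distribˡ-+ (2 ℕ.* R) _ _))
      (ℕ.≤-trans (ℕ.+-mono-≤ (few-bad Γ a b R n-positive (few-cross′ sc st))
        (few-bad (transpose Γ) b a R n-positive
          (subst (λ c → c ℕ.* (R ℕ.* R) ℕ.≤ n ℕ.* n) (sym (cross-transpose Γ a b)) (few-cross′ sc st))))
      (ℕ.≤-trans (ℕ.≤-reflexive (cong (n ℕ.+_) (sym (ℕ.+-identityʳ n)))) (ℕ.m≤n*m (2 ℕ.* n) 2)))))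

sizes-close : ∀ {n R x y} .{{_ : ℕ.NonZero R}} → R ℕ.* x ℕ.≤ R ℕ.* y ℕ.+ 2 ℕ.* n →
  toℚ x ≤ toℚ y + toℚ 2 * unit R * toℚ n
sizes-close {n} {R} {x} {y} h =
  subst (λ e → toℚ x ≤ toℚ y + e) (sym (2ρn R n)) (≤-unscaleʳ R y (2 ℕ.* n) x h)

-- Makes the division in (v) legitimate, which is stated multiplied out.
positive-margin : ∀ {n d A t} R .{{_ : ℕ.NonZero R}} → Scale n d A t R →
  0ℚ < toℚ d - toℚ 2 * unit R * toℚ n
positive-margin {n} {d} R sc = p<q⇒0<q-p (begin-strict
  toℚ 2 * unit R * toℚ n        ≡⟨ 2ρn R n ⟩
  unit R * toℚ (2 ℕ.* n)        <⟨ <-unscale₀ R (2 ℕ.* n) d (2n<Rd sc) ⟩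
  toℚ d                         ∎)
  where open ≤-Reasoning

classes-bound : ∀ {n d} k R .{{_ : ℕ.NonZero R}} → R ℕ.* (k ℕ.* d) ℕ.≤ R ℕ.* n ℕ.+ k ℕ.* (2 ℕ.* n) →
  toℚ k * (toℚ d - toℚ 2 * unit R * toℚ n) ≤ toℚ n
classes-bound {n} {d} k R h = begin
  toℚ k * (toℚ d - toℚ 2 * unit R * toℚ n)              ≡⟨ cong (λ e → toℚ k * (toℚ d - e)) (2ρn R n) ⟩
  toℚ k * (toℚ d - unit R * toℚ (2 ℕ.* n))              ≡⟨ lemma (toℚ k) (toℚ d) (unit R) (toℚ (2 ℕ.* n)) ⟩
  toℚ k * toℚ d - unit R * (toℚ k * toℚ (2 ℕ.* n))      ≡⟨ cong₂ (λ p q → p - unit R * q) (sym (toℚ-* k d)) (sym (toℚ-* k (2 ℕ.* n))) ⟩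
  toℚ (k ℕ.* d) - unit R * toℚ (k ℕ.* (2 ℕ.* n))        ≤⟨ p≤q+r⇒p-r≤q (toℚ (k ℕ.* d)) (toℚ n) _ (≤-unscaleʳ R n (k ℕ.* (2 ℕ.* n)) (k ℕ.* d) h) ⟩
  toℚ n                                                 ∎
  where
  open ≤-Reasoning
  lemma : ∀ k d u m → k * (d - u * m) ≡ k * d - u * (k * m)
  lemma = solve 4 (λ k d u m → k :* (d :- u :* m) := k :* d :- u :* (k :* m)) refl where open +-*-Solver

-- Replaces `α` by the integer `A` with `1/A ≤ α`: then `n ≤ αAn ≤ Ad`.
degree-lower-bound : ∀ {α A n d} → 1ℚ ≤ α * toℚ A → α * toℚ n ≤ toℚ d → n ℕ.≤ A ℕ.* d
degree-lower-bound {α} {A} {n} {d} 1≤αA αn≤d = toℚ-cancel-≤ {n} {A ℕ.* d} (begin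
  toℚ n                  ≡⟨ *-identityˡ (toℚ n) ⟨
  1ℚ * toℚ n             ≤⟨ *-monoʳ-≤-nonNeg (toℚ n) 1≤αA ⟩
  α * toℚ A * toℚ n      ≡⟨ lemma α (toℚ A) (toℚ n) ⟩
  toℚ A * (α * toℚ n)    ≤⟨ *-monoˡ-≤-nonNeg (toℚ A) αn≤d ⟩
  toℚ A * toℚ d          ≡⟨ toℚ-* A d ⟨
  toℚ (A ℕ.* d)          ∎)
  where
  open ≤-Reasoning
  instance
    _ = toℚ-nonNeg n
    _ = toℚ-nonNeg A
  lemma : ∀ α a n → α * a * n ≡ a * (α * n)
  lemma = solve 3 (λ α a n → α :* a :* n := a :* (α :* n)) refl where open +-*-Solver

degree≤n : ∀ {n d} (Γ : Biregular n d) → 0 ℕ.< n → d ℕ.≤ n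
degree≤n {suc n} Γ _ = ℕ.≤-trans (ℕ.≤-reflexive (sym (out-regular Γ zero))) (count≤n (adj Γ zero))


optimal-on-part : ∀ {n d k} (Γ : Biregular n d) (a b : Fin n → Fin k) → Optimal Γ a b → Optimal (transpose Γ) b a →
  ∀ i j x → class a i x ∧ class b j x ≡ true → ∀ i′ j′ →
  deg Γ x b i′ ℕ.≤ deg Γ x b i × deg (transpose Γ) x a j′ ℕ.≤ deg (transpose Γ) x a j
optimal-on-part Γ a b rows cols i j x x∈ i′ j′ with ∧-true {class a i x} x∈
... | x∈Aᵢ , x∈Bⱼ with ⌊⌋-true (a x ≟ i) x∈Aᵢ | ⌊⌋-true (b x ≟ j) x∈Bⱼ
... | refl | refl = rows x i′ , cols x j′

-- The process starts from a single class: no edge is foreign, the class is the whole vertex set,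
-- and `2 * A` splits are in reserve.
outcome : ∀ {f A t E₀ n₁ n d} → 0 ℕ.< A → 0 ℕ.< t → Reaches f A t (2 ℕ.* A) E₀ n₁ →
  n₁ ℕ.< n → (Γ : Biregular n d) → n ℕ.≤ A ℕ.* d → Outcome f (suc n₁) A t Γ
outcome {A = A} {t} {E₀} {n₁} {n} 0<A 0<t reach n₁<n Γ dense =
  reach {k = 0} (ℕ.n≤1+n n₁) n₁<n Γ dense (degree≤n Γ (ℕ.≤-trans (ℕ.s≤s ℕ.z≤n) n₁<n)) (λ _ → zero) (λ _ → zero)
    (subst (λ c → c ℕ.* E₀ ℕ.≤ n ℕ.* n) (sym (cross-single Γ)) ℕ.z≤n)
    (λ { zero → ℕ.≤-trans (ℕ.≤-reflexive (sym (count-true n))) (ℕ.m≤n*m (count {n} (λ _ → true)) (4 ℕ.* A ℕ.* t)) })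
    -- The split budget reads `2 * A < 1 + 2 * A`.
    ℕ.≤-refl
  where
  instance
    _ = ℕ.>-nonZero 0<A
    _ = ℕ.>-nonZero 0<t
    _ = ℕ.m*n≢0 (4 ℕ.* A) t {{ℕ.m*n≢0 4 A}}

theorem3p5 : (α τ : ℚ) → 0ℚ < α → 0ℚ < τ →
    (f : ℚ → ℚ) → MapsUnitInterval f → NonDecreasingOnUnit f →
    ∃[ n₀ ] (∀ (n : ℕ) → n₀ ℕ.≤ n → (G : Digraph n) → (d : ℕ) → Regular G d →
    α * toℚ n ≤ toℚ d →
    ∃[ ρ ] ∃[ ν ]
    ( (1ℚ ≤ ρ * toℚ n₀) × (ρ ≤ ν) × (ν ≤ τ) × (ν < 1ℚ)
    × (ρ ≤ f ν) × (1ℚ ≤ f ρ * toℚ n₀)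
    × ∃[ k ] Σ[ p ∈ (Fin n → Fin (suc k) × Fin (suc k)) ]
    ( (∀ i → BipRobustExpander G (Vrow p i) (Vcol p i) ν τ)
    × (∀ i j x → Vij p i j x ≡ true → ∀ i' j' →
    (outdeg G x (Vcol p i') ℕ.≤ outdeg G x (Vcol p i))
    × (indeg G x (Vrow p j') ℕ.≤ indeg G x (Vrow p j)))
    × (∀ i → MinDegBip≥Frac G (Vrow p i) (Vcol p i) d (suc k))
    × (∀ i → (toℚ ∣ Vrow p i ∣ˢ ≤ toℚ ∣ Vcol p i ∣ˢ + toℚ 2 * ρ * toℚ n)
    × (toℚ ∣ Vcol p i ∣ˢ ≤ toℚ ∣ Vrow p i ∣ˢ + toℚ 2 * ρ * toℚ n))
    × (∀ i j → toℚ (count (λ x → Vij p i j x ∧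
    not (((toℚ d - toℚ 2 * ρ * toℚ n) ≤ᵇ toℚ (outdeg G x (Vcol p i)))
    ∧ ((toℚ d - toℚ 2 * ρ * toℚ n) ≤ᵇ toℚ (indeg G x (Vrow p j))))))
    ≤ toℚ 2 * ρ * toℚ n)
    × ((0ℚ < toℚ d - toℚ 2 * ρ * toℚ n)
    × (toℚ (suc k) * (toℚ d - toℚ 2 * ρ * toℚ n) ≤ toℚ n)) ) ))
-- Taking `suc n₁` makes every admissible `n` positive.
theorem3p5 α τ 0<α 0<τ f f∈ f↑ = suc n₁ , λ n n₁<n G d reg αn≤d →
  let Γ = biregular G reg
      open Outcome (outcome 0<A 0<t reach n₁<n Γ (degree-lower-bound {α} {A} {n} {d} 1≤αA αn≤d))
      instance _ = N≢0 ; _ = R≢0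
  in
    unit R , unit N ,
    1≤*-mono R (suc n₁) (unit>0 R) R≤n₀ (unit≤⇒1≤ R ≤-refl) ,
    unit-anti N R N≤R ,
    ≤-trans (unit-anti t N t≤N) t≤τ ,
    unit<1 N 1<N ,
    ρ≤fν , 1≤fρ , k , (λ x → row x , col x) ,
    bip-expander G reg row col t≤τ expands ,
    optimal-on-part Γ row col rows-opt cols-opt ,
    (λ i → (λ u u∈ → subst (λ j → d ℕ.≤ suc k ℕ.* deg Γ u col j) (⌊⌋-true (row u ≟ i) u∈) (min-degree Γ row col rows-opt u)) ,
           (λ w w∈ → subst (λ j → d ℕ.≤ suc k ℕ.* deg (transpose Γ) w row j) (⌊⌋-true (col w ≟ i) w∈) (min-degree (transpose Γ) col row cols-opt w))) ,
    (λ i → sizes-close {n} {R} {count (class row i)} {count (class col i)} (size-difference Γ row col scale (few-cross partition) i) ,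
           sizes-close {n} {R} {count (class col i)} {count (class row i)} (size-difference (transpose Γ) col row scale
             (subst (λ c → c ℕ.* (R ℕ.* R ℕ.* A) ℕ.≤ n ℕ.* n) (sym (cross-transpose Γ row col)) (few-cross partition)) i)) ,
    few-exceptional Γ row col scale partition ,
    positive-margin R scale ,
    classes-bound (suc k) R (classes-fit scale partition)
  where
  A = proj₁ (archimedean α 0<α)
  t = proj₁ (archimedean τ 0<τ)
  instance t≢0 = proj₁ (proj₂ (archimedean τ 0<τ))
  1≤αA = proj₂ (proj₂ (archimedean α 0<α))
  t≤τ = 1≤⇒unit≤ t (proj₂ (proj₂ (archimedean τ 0<τ)))
  0<A = ℕ.>-nonZero⁻¹ A {{proj₁ (proj₂ (archimedean α 0<α))}}
  0<t = ℕ.>-nonZero⁻¹ t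
  stages = reaches f A t 0<A 0<t f∈ (2 ℕ.* A)
  n₁ = proj₁ (proj₂ stages)
  reach = proj₂ (proj₂ stages)
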